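{- Let $u$ be a packed word of length $n$ with $\max(u)=r$, and let $\mathbf{K}_u:=\mathbf{N}_u*E_n^{[r]}\in\mathbf{WQSym}_n^*$. Then $$\mathbf{K}_u=\sum_{v\ge u}\frac{(-1)^{\max(v)-\max(u)}}{\prod_{i=1}^{r}\ell_i(v,u)}\,\mathbf{N}_v,$$ where the sum is over packed words $v$ of length $n$ finer than $u$, and $\ell_i(v,u)$ is the number of distinct letters $v_j$ with $u_j=i$ (i.e. the number of blocks of $v$ contained in the $i$-th block of $u$).
   Context: $\mathbb{K}$ is a field of characteristic $0$. A word over the positive integers is packed if its set of letters is $\{1,\dots,r\}$ for some $r$; then $r=\max(u)$. For a word $w$ over a totally ordered alphabet with distinct letters $b_1<\dots<b_r$, $\mathrm{pack}(w)$ is obtained by replacing each $b_i$ by $i$. A packed word $u=u_1\cdots u_n$ is identified with the set composition (ordered set partition) of $\{1,\dots,n\}$ whose $i$-th block is $\{j: u_j=i\}$. For packed words $u,v$ of length $n$, $v$ is finer than $u$, written $v\ge u$, if the set composition $u$ is obtained from $v$ by merging some consecutive blocks (equivalently $v_i\le v_j\Rightarrow u_i\le u_j$ for all $i,j$). $\mathbf{WQSym}^*_n$ is the $\mathbb{K}$-vector space with basis $\mathbf{N}_u$, $u$ running over packed words of length $n$, with internal product $\mathbf{N}_u*\mathbf{N}_v=\mathbf{N}_{\mathrm{pack}\binom{u}{v}}$, where $\binom{u}{v}$ is the word of biletters $\binom{u_1}{v_1}\cdots\binom{u_n}{v_n}$, biletters being ordered lexicographically with priority to the top letter. The Eulerian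 idempotents $E_n^{[k]}$ are the elements of $\mathbf{WQSym}_n^*$ defined by $$\sum_{k=1}^n t^kE_n^{[k]}=\sum_{|u|=n}\binom{t}{\max(u)}\mathbf{N}_u ,$$ the sum being over all packed words of length $n$ (this is the degree $n$ component of $\sigma_1^t$, where $\sigma_1=\sum_{n\ge 0}S_n$ and $S_n=\mathbf{N}_{1^n}$), $t$ being an indeterminate. -}

module Defs where

open import Algebra.Apartness.Bundles using (HeytingField; module HeytingCommutativeRing)
open import Algebra.Bundles using (CommutativeRing; module Semiring)
import Algebra.Definitions.RawMonoid as RawMonoidDefs
import Algebra.Definitions.RawSemiring as RawSemiringDefs
import Algebra.Properties.Ring as RingProperties
open import Data.Bool.Base using (if_then_else_)
open import Data.Fin.Base as Fin using (Fin; toℕ; fromℕ<)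
import Data.Fin.Properties as Fin
open import Data.List.Base as List
  using (List; []; _∷_; allFin; cartesianProductWith; deduplicate; filter; foldr; length; mapMaybe; upTo)
open import Data.List.Membership.Propositional using () renaming (_∈_ to _∈ₗ_)
import Data.List.Membership.Propositional.Properties as ∈ₗ
import Data.List.Properties as List
open import Data.List.Relation.Unary.All as All using (All)
import Data.List.Relation.Unary.All.Properties as All
open import Data.List.Relation.Unary.AllPairs as AllPairs using (AllPairs; []; _∷_)
open import Data.List.Relation.Unary.Any as Any using (Any; here; there)
import Data.List.Relation.Unary.Any.Properties as Any
open import Data.List.Relation.Unary.Unique.Propositional using (Unique)
import Data.List.Relation.Unary.Unique.Propositional.Properties as Unique
import Data.List.Relation.Unary.Unique.DecSetoid.Properties as UniqueDec
open import Data.Maybe.Base using (Maybe; just; nothing)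
open import Data.Nat as ℕ using (ℕ; zero; suc; z≤n; s≤s; NonZero; _!)
open import Data.Nat.ListAction using (product)
open import Data.Nat.ListAction.Properties using (product≢0)
import Data.Nat.Properties as ℕ
open import Data.Product.Base using (_×_; _,_; proj₁; proj₂; ∃-syntax)
open import Data.Product.Relation.Binary.Lex.NonStrict using (×-decTotalOrder)
open import Data.Sum.Base using (inj₁; inj₂)
open import Data.Vec.Base as Vec using (Vec; []; _∷_; lookup; toList)
open import Data.Vec.Membership.Propositional using (_∈_)
import Data.Vec.Membership.DecPropositional ℕ._≟_ as ∈?
import Data.Vec.Membership.Propositional.Properties as ∈
import Data.Vec.Properties as Vec
open import Data.Vec.Relation.Unary.Any as VecAny using (here; there)
import Data.Vec.Relation.Unary.Any.Properties as VecAny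
open import Function.Base using (_∘_; id)
open import Function.Bundles using (_⇔_; mk⇔; module Equivalence)
open import Relation.Binary.Bundles using (DecTotalOrder)
open import Relation.Binary.Definitions using (DecidableEquality; tri<; tri≈; tri>)
open import Relation.Binary.PropositionalEquality as ≡
  using (_≡_; refl; cong; subst)
open import Relation.Nullary.Decidable
  using (Dec; yes; no; does; map′; recompute; _×-dec_; _→-dec_)
open import Relation.Nullary.Negation using (¬_; contradiction)

Packed : ∀ {n} → Vec ℕ n → Set
Packed w = ∃[ r ] (∀ a → a ∈ w ⇔ (1 ℕ.≤ a × a ℕ.≤ r))

-- The proof is irrelevant, so that equality of packed words is equality of
-- words; it can be recovered with `recompute` from `packed?` below.
record PackedWord (n : ℕ) : Set where
  constructor packedWord
  field
    word      : Vec ℕ n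
    .isPacked : Packed word

open PackedWord public

maxLetter : ∀ {n} → Vec ℕ n → ℕ
maxLetter = Vec.foldr′ ℕ._⊔_ 0

max : ∀ {n} → PackedWord n → ℕ
max u = maxLetter (word u)

word-injective : ∀ {n} {u v : PackedWord n} → word u ≡ word v → u ≡ v
word-injective refl = refl

infix 4 _≟_
_≟_ : ∀ {n} → DecidableEquality (PackedWord n)
u ≟ v = map′ word-injective (cong word) (Vec.≡-dec ℕ._≟_ (word u) (word v))

≤-maxLetter : ∀ {n a} {w : Vec ℕ n} → a ∈ w → a ℕ.≤ maxLetter w
≤-maxLetter {w = b ∷ w} (here refl) = ℕ.m≤m⊔n b (maxLetter w)
≤-maxLetter {w = b ∷ w} (there a∈w) = ℕ.≤-trans (≤-maxLetter a∈w) (ℕ.m≤n⊔m b (maxLetter w))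

maxLetter-∈ : ∀ {n} (w : Vec ℕ n) → 1 ℕ.≤ maxLetter w → maxLetter w ∈ w
maxLetter-∈ (b ∷ w) 1≤m with ℕ.⊔-sel b (maxLetter w)
... | inj₁ eq = subst (_∈ (b ∷ w)) (≡.sym eq) (here refl)
... | inj₂ eq = subst (_∈ (b ∷ w)) (≡.sym eq)
                  (there (maxLetter-∈ w (subst (1 ℕ.≤_) eq 1≤m)))

packed⇒max : ∀ {n} {w : Vec ℕ n} → Packed w → ∀ a → a ∈ w ⇔ (1 ℕ.≤ a × a ℕ.≤ maxLetter w)
packed⇒max {w = w} (r , p) a = mk⇔
  (λ a∈w → proj₁ (to (p a) a∈w) , ≤-maxLetter a∈w)
  (λ (1≤a , a≤m) → from (p a) (1≤a , ℕ.≤-trans a≤m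
     (proj₂ (to (p (maxLetter w)) (maxLetter-∈ w (ℕ.≤-trans 1≤a a≤m))))))
  where open Equivalence

packed? : ∀ {n} (w : Vec ℕ n) → Dec (Packed w)
packed? w = map′ fwd bwd
  (Fin.all? (λ i → 1 ℕ.≤? lookup w i) ×-dec
   ℕ.allUpTo? (λ a → suc a ∈?.∈? w) (maxLetter w))
  where
  open Equivalence
  fwd : (∀ i → 1 ℕ.≤ lookup w i) × (∀ {a} → a ℕ.< maxLetter w → suc a ∈ w) → Packed w
  fwd (pos , all) = maxLetter w , λ a → mk⇔
    (λ a∈w → subst (1 ℕ.≤_) (≡.sym (VecAny.lookup-index a∈w)) (pos (VecAny.index a∈w))
           , ≤-maxLetter a∈w)
    (λ { (s≤s _ , a≤m) → all a≤m })
  bwd : Packed w → (∀ i → 1 ℕ.≤ lookup w i) × (∀ {a} → a ℕ.< maxLetter w → suc a ∈ w)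
  bwd p = (λ i → proj₁ (to (packed⇒max p _) (∈.∈-lookup i w)))
        , (λ {a} a<m → from (packed⇒max p (suc a)) (s≤s z≤n , a<m))

packedProof : ∀ {n} (u : PackedWord n) → Packed (word u)
packedProof (packedWord w p) = recompute (packed? w) p

words : ℕ → ∀ n → List (Vec ℕ n)
words m zero    = [] ∷ []
words m (suc n) = cartesianProductWith _∷_ (List.map suc (upTo m)) (words m n)

toPacked : ∀ {n} → Vec ℕ n → Maybe (PackedWord n)
toPacked w with packed? w
... | yes p = just (packedWord w p)
... | no  _ = nothing

-- The letters of a packed word of length n are at most n.
packedWords : ∀ n → List (PackedWord n)
packedWords n = mapMaybe toPacked (words n n)

private
  ∈-words : ∀ m {n} (w : Vec ℕ n) → (∀ {a} → a ∈ w → 1 ℕ.≤ a × a ℕ.≤ m) → w ∈ₗ words m n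
  ∈-words m []      p = here refl
  ∈-words m (a ∷ w) p = ∈ₗ.∈-cartesianProductWith⁺ _∷_ (letter (p (here refl)))
                          (∈-words m w (p ∘ there))
    where
    letter : ∀ {a} → 1 ℕ.≤ a × a ℕ.≤ m → a ∈ₗ List.map suc (upTo m)
    letter (s≤s _ , a≤m) = ∈ₗ.∈-map⁺ suc (∈ₗ.∈-upTo⁺ a≤m)

  words-unique : ∀ m n → Unique (words m n)
  words-unique m zero    = All.[] ∷ []
  words-unique m (suc n) = Unique.cartesianProductWith⁺ _∷_
    (λ eq → Vec.∷-injective eq)
    (Unique.map⁺ ℕ.suc-injective (Unique.upTo⁺ m)) (words-unique m n)

  max≤length : ∀ {n} (u : PackedWord n) → max u ℕ.≤ n
  max≤length u = Fin.injective⇒≤ {f = pos} pos-injective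
    where
    open Equivalence
    occurs : (i : Fin (max u)) → suc (toℕ i) ∈ word u
    occurs i = from (packed⇒max (packedProof u) _) (s≤s z≤n , Fin.toℕ<n i)
    pos : Fin (max u) → Fin _
    pos i = VecAny.index (occurs i)
    pos-injective : ∀ {i j} → pos i ≡ pos j → i ≡ j
    pos-injective {i} {j} eq = Fin.toℕ-injective (ℕ.suc-injective
      (≡.trans (VecAny.lookup-index (occurs i))
        (≡.trans (cong (lookup (word u)) eq) (≡.sym (VecAny.lookup-index (occurs j))))))

  ∈-toPacked⁺ : ∀ {n} (u : PackedWord n) (ws : List (Vec ℕ n)) →
                word u ∈ₗ ws → u ∈ₗ mapMaybe toPacked ws
  ∈-toPacked⁺ u (w ∷ ws) (here refl) with packed? w
  ... | yes _ = here refl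
  ... | no ¬p = contradiction (packedProof u) ¬p
  ∈-toPacked⁺ u (w ∷ ws) (there u∈) with packed? w
  ... | yes _ = there (∈-toPacked⁺ u ws u∈)
  ... | no  _ = ∈-toPacked⁺ u ws u∈

  map-word : ∀ {n} (ws : List (Vec ℕ n)) →
             List.map word (mapMaybe toPacked ws) ≡ filter packed? ws
  map-word []       = refl
  map-word (w ∷ ws) with packed? w
  ... | yes p = ≡.trans (cong (w ∷_) (map-word ws)) (≡.sym (List.filter-accept packed? p))
  ... | no ¬p = ≡.trans (map-word ws) (≡.sym (List.filter-reject packed? ¬p))

packedWords-complete : ∀ {n} (u : PackedWord n) → u ∈ₗ packedWords n
packedWords-complete {n} u = ∈-toPacked⁺ u (words n n) (∈-words n (word u) λ a∈u →
  let (1≤a , a≤m) = Equivalence.to (packed⇒max (packedProof u) _) a∈u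
  in 1≤a , ℕ.≤-trans a≤m (max≤length u))

packedWords-unique : ∀ n → Unique (packedWords n)
packedWords-unique n = Unique.map⁻ {f = word}
  (subst Unique (≡.sym (map-word (words n n))) (Unique.filter⁺ packed? (words-unique n n)))

module Packing {c ℓ₁ ℓ₂} (A : DecTotalOrder c ℓ₁ ℓ₂) where

  private module A = DecTotalOrder A
  open A using (Carrier; _≈_; _≤?_)

  distinctLetters : ∀ {n} → Vec Carrier n → List Carrier
  distinctLetters w = deduplicate A._≟_ (toList w)

  countBelow : List Carrier → Carrier → ℕ
  countBelow bs a = length (filter (_≤? a) bs)

  -- If b₁ < ⋯ < bᵣ are the distinct letters of w, then i is the number of
  -- j with bⱼ ≤ bᵢ.
  packLetters : ∀ {n} → Vec Carrier n → Vec ℕ n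
  packLetters w = Vec.map (countBelow (distinctLetters w)) w

  private
    count-mono : ∀ bs {a b} → a A.≤ b → countBelow bs a ℕ.≤ countBelow bs b
    count-mono []       a≤b = z≤n
    count-mono (x ∷ bs) {a} {b} a≤b with x ≤? a | x ≤? b
    ... | yes _   | yes _   = s≤s (count-mono bs a≤b)
    ... | yes x≤a | no  x≰b = contradiction (A.trans x≤a a≤b) x≰b
    ... | no  _   | yes _   = ℕ.m≤n⇒m≤1+n (count-mono bs a≤b)
    ... | no  _   | no  _   = count-mono bs a≤b

    count-cong : ∀ bs {a b} → a ≈ b → countBelow bs a ≡ countBelow bs b
    count-cong bs a≈b = ℕ.≤-antisym (count-mono bs (A.reflexive a≈b))
                                    (count-mono bs (A.reflexive (A.Eq.sym a≈b)))

    count-strict : ∀ {bs a b} → b ∈ₗ bs → ¬ (b A.≤ a) → countBelow bs a ℕ.< countBelow bs b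
    count-strict {x ∷ bs} {a} {b} (here refl) b≰a with x ≤? a | x ≤? b
    ... | yes x≤a | _      = contradiction x≤a b≰a
    ... | no  _   | no x≰x = contradiction A.refl x≰x
    ... | no  _   | yes _  = s≤s (count-mono bs (a≤ (A.total a x)))
      where
      a≤ : _ → a A.≤ x
      a≤ (inj₁ a≤x) = a≤x
      a≤ (inj₂ x≤a) = contradiction x≤a b≰a
    count-strict {x ∷ bs} {a} {b} (there b∈) b≰a with x ≤? a | x ≤? b
    ... | yes _   | yes _   = s≤s (count-strict b∈ b≰a)
    ... | no  _   | yes _   = ℕ.m≤n⇒m≤1+n (count-strict b∈ b≰a)
    ... | no  _   | no  _   = count-strict b∈ b≰a
    ... | yes x≤a | no  x≰b with A.total a b
    ...   | inj₁ a≤b = contradiction (A.trans x≤a a≤b) x≰b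
    ...   | inj₂ b≤a = contradiction b≤a b≰a

    count-positive : ∀ {bs a} → Any (_≈ a) bs → 1 ℕ.≤ countBelow bs a
    count-positive {x ∷ bs} {a} p with x ≤? a
    ... | yes _ = s≤s z≤n
    count-positive {x ∷ bs} {a} (here x≈a) | no x≰a = contradiction (A.reflexive x≈a) x≰a
    count-positive {x ∷ bs} {a} (there p)  | no _   = count-positive p

    count-onto : ∀ {bs} → AllPairs (λ a b → ¬ (a ≈ b)) bs →
                 ∀ i → 1 ℕ.≤ i → i ℕ.≤ length bs → Any (λ b → countBelow bs b ≡ i) bs
    count-onto {[]}     []        i 1≤i i≤0 = contradiction (ℕ.≤-trans 1≤i i≤0) λ ()
    count-onto {x ∷ bs} (x≉ ∷ ps) i 1≤i i≤
      with ℕ.<-cmp i (suc (countBelow bs x))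
    ... | tri< (s≤s i≤c) _ _ = there (go (count-onto ps i 1≤i
            (ℕ.≤-trans i≤c (List.length-filter (_≤? x) bs))) id)
      where
      step : ∀ {b} → b ∈ₗ bs → countBelow bs b ≡ i → countBelow (x ∷ bs) b ≡ i
      step {b} b∈ eq with x ≤? b
      ... | no  _ = eq
      ... | yes x≤b with b ≤? x
      ...   | yes b≤x = contradiction (A.antisym x≤b b≤x) (All.lookup x≉ b∈)
      ...   | no  b≰x = contradiction (ℕ.≤-<-trans i≤c (count-strict b∈ b≰x))
                          (ℕ.<-irrefl (≡.sym eq))
      go : ∀ {cs} → Any (λ b → countBelow bs b ≡ i) cs → (∀ {b} → b ∈ₗ cs → b ∈ₗ bs) →
           Any (λ b → countBelow (x ∷ bs) b ≡ i) cs
      go (here eq) sub = here (step (sub (here refl)) eq)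
      go (there p) sub = there (go p (sub ∘ there))
    ... | tri≈ _ refl _ = here eqx
      where
      eqx : countBelow (x ∷ bs) x ≡ suc (countBelow bs x)
      eqx with x ≤? x
      ... | yes _   = refl
      ... | no  x≰x = contradiction A.refl x≰x
    ... | tri> _ _ c<i with i
    ...   | suc k = there (go (count-onto ps k (ℕ.≤-trans (s≤s z≤n) (ℕ.s≤s⁻¹ c<i)) (ℕ.s≤s⁻¹ i≤)))
      where
      step : ∀ {b} → countBelow bs b ≡ k → countBelow (x ∷ bs) b ≡ suc k
      step {b} eq with x ≤? b
      ... | yes _ = cong suc eq
      ... | no  x≰b with A.total x b
      ...   | inj₁ x≤b = contradiction x≤b x≰b
      ...   | inj₂ b≤x = contradiction (ℕ.≤-<-trans (count-mono bs b≤x) (ℕ.s≤s⁻¹ c<i))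
                           (ℕ.<-irrefl eq)
      go : ∀ {cs} → Any (λ b → countBelow bs b ≡ k) cs → Any (λ b → countBelow (x ∷ bs) b ≡ suc k) cs
      go = Any.map step

  packLetters-packed : ∀ {n} (w : Vec Carrier n) → Packed (packLetters w)
  packLetters-packed w = length bs , λ a → mk⇔ fwd (λ (1≤a , a≤r) → bwd 1≤a a≤r)
    where
    bs : List Carrier
    bs = distinctLetters w

    onto : ∀ {n a} {w : Vec Carrier n} → Any (λ b → countBelow bs b ≡ a) (toList w) →
           a ∈ Vec.map (countBelow bs) w
    onto {w = x ∷ w} (here eq) = here (≡.sym eq)
    onto {w = x ∷ w} (there p) = there (onto p)

    bwd : ∀ {a} → 1 ℕ.≤ a → a ℕ.≤ length bs → a ∈ packLetters w
    bwd {a} 1≤a a≤r = onto (Any.deduplicate⁻ A._≟_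
      (count-onto (UniqueDec.deduplicate-! A.Eq.decSetoid (toList w)) a 1≤a a≤r))

    letter : ∀ {n a} {w : Vec Carrier n} → a ∈ Vec.map (countBelow bs) w →
             ∃[ x ] (x ∈ₗ toList w × a ≡ countBelow bs x)
    letter {w = x ∷ w} (here eq) = x , here refl , eq
    letter {w = x ∷ w} (there p) = let (y , y∈ , eq) = letter p in y , there y∈ , eq

    fwd : ∀ {a} → a ∈ packLetters w → 1 ℕ.≤ a × a ℕ.≤ length bs
    fwd a∈ with letter {w = w} a∈
    ... | x , x∈ , refl =
      count-positive (Any.deduplicate⁺ A._≟_ (λ y≈z z≈x → A.Eq.trans y≈z z≈x)
        (Any.map (λ { refl → A.Eq.refl }) x∈))
      , List.length-filter (_≤? x) bs

  pack : ∀ {n} → Vec Carrier n → PackedWord n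
  pack w = packedWord (packLetters w) (packLetters-packed w)

-- pack of the word of biletters (uᵢ over vᵢ), ordered lexicographically
-- with priority to uᵢ
packBi : ∀ {n} → PackedWord n → PackedWord n → PackedWord n
packBi u v = pack (Vec.zip (word u) (word v))
  where open Packing (×-decTotalOrder ℕ.≤-decTotalOrder ℕ.≤-decTotalOrder)

-- v is finer than u: u arises by merging consecutive blocks of v, i.e. vᵢ ≤ vⱼ
-- implies uᵢ ≤ uⱼ.
infix 4 _≽_
_≽_ : ∀ {n} → PackedWord n → PackedWord n → Set
v ≽ u = ∀ i j → lookup (word v) i ℕ.≤ lookup (word v) j → lookup (word u) i ℕ.≤ lookup (word u) j

infix 4 _≽?_
_≽?_ : ∀ {n} (v u : PackedWord n) → Dec (v ≽ u)
v ≽? u = Fin.all? λ i → Fin.all? λ j →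
  (lookup (word v) i ℕ.≤? lookup (word v) j) →-dec (lookup (word u) i ℕ.≤? lookup (word u) j)

finerThan : ∀ {n} → PackedWord n → List (PackedWord n)
finerThan {n} u = filter (_≽? u) (packedWords n)

-- ℓᵢ(v,u), the number of distinct letters vⱼ with uⱼ = i
blocksIn : ∀ {n} → ℕ → PackedWord n → PackedWord n → ℕ
blocksIn {n} i v u = length (deduplicate ℕ._≟_
  (List.map (lookup (word v)) (filter (λ j → lookup (word u) j ℕ.≟ i) (allFin n))))

-- ∏ ℓᵢ(v,u) for 1 ≤ i ≤ max u
blocksProduct : ∀ {n} → PackedWord n → PackedWord n → ℕ
blocksProduct v u = product (List.map (λ i → blocksIn i v u) (List.map suc (upTo (max u))))

blocksProduct≢0 : ∀ {n} (v u : PackedWord n) → NonZero (blocksProduct v u)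
blocksProduct≢0 {n} v u = product≢0 (All.map⁺ (All.map⁺ (All.tabulate λ i∈ → nz (∈ₗ.∈-upTo⁻ i∈))))
  where
  nonempty : ∀ {x : ℕ} {xs} → x ∈ₗ xs → NonZero (length (deduplicate ℕ._≟_ xs))
  nonempty (here  _) = _
  nonempty (there _) = _
  nz : ∀ {i} → i ℕ.< max u → NonZero (blocksIn (suc i) v u)
  nz {i} i<m = nonempty (∈ₗ.∈-map⁺ (lookup (word v))
    (∈ₗ.∈-filter⁺ (λ j → lookup (word u) j ℕ.≟ suc i) (∈ₗ.∈-allFin (VecAny.index i∈u))
      (≡.sym (VecAny.lookup-index i∈u))))
    where
    i∈u : suc i ∈ word u
    i∈u = Equivalence.from (packed⇒max (packedProof u) (suc i)) (s≤s z≤n , i<m)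

-- In a Heyting field, being apart from 0 (rather than merely different from 0)
-- is equivalent to being invertible.
CharacteristicZero : ∀ {c ℓ₁ ℓ₂} → HeytingField c ℓ₁ ℓ₂ → Set ℓ₂
CharacteristicZero 𝕂 = ∀ n → .{{NonZero n}} → (n · 1#) # 0#
  where
  open HeytingField 𝕂
  open CommutativeRing (HeytingCommutativeRing.commutativeRing heytingCommutativeRing)
    using (+-rawMonoid)
  open RawMonoidDefs +-rawMonoid using () renaming (_×_ to _·_)

module WQSym {c ℓ₁ ℓ₂} (𝕂 : HeytingField c ℓ₁ ℓ₂) (char0 : CharacteristicZero 𝕂) where

  open HeytingField 𝕂 public
    using (Carrier; _≈_; _#_; _+_; _*_; -_; 0#; 1#; heytingCommutativeRing; #⇒invertible)
  commutativeRing : CommutativeRing c ℓ₁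
  commutativeRing = HeytingCommutativeRing.commutativeRing heytingCommutativeRing

  private module K = CommutativeRing commutativeRing
  open RawSemiringDefs (Semiring.rawSemiring K.semiring) public using (_^_) renaming (_×_ to _·_)

  fromℕ : ℕ → Carrier
  fromℕ n = n · 1#

  infix 8 1/_
  1/_ : ∀ n → .{{NonZero n}} → Carrier
  1/ n = proj₁ (#⇒invertible (char0 n))

  1/-inverse : ∀ n → .{{_ : NonZero n}} → fromℕ n * 1/ n ≈ 1#
  1/-inverse n = K.trans
    (K.*-congʳ (K.sym (K.trans (K.+-congˡ -0#≈0#) (K.+-identityʳ (fromℕ n)))))
    (proj₂ (proj₂ (#⇒invertible (char0 n))))
    where open RingProperties K.ring using (-0#≈0#)

  -- Polynomials in t, as lists of coefficients by increasing degree; trailing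
  -- zeros are allowed
  Poly : Set c
  Poly = List Carrier

  coeff : ℕ → Poly → Carrier
  coeff _       []      = 0#
  coeff zero    (a ∷ p) = a
  coeff (suc k) (a ∷ p) = coeff k p

  infixl 6 _⊕_
  infixl 7 _⊗_ _∙_

  _⊕_ : Poly → Poly → Poly
  []      ⊕ q       = q
  (a ∷ p) ⊕ []      = a ∷ p
  (a ∷ p) ⊕ (b ∷ q) = (a + b) ∷ (p ⊕ q)

  _∙_ : Carrier → Poly → Poly
  a ∙ p = List.map (a *_) p

  _⊗_ : Poly → Poly → Poly
  []      ⊗ q = []
  (a ∷ p) ⊗ q = (a ∙ q) ⊕ (0# ∷ (p ⊗ q))

  -- t (t - 1) ⋯ (t - m + 1); the last factor is -(m - 1) + 1·t
  fallingFactorial : ℕ → Poly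
  fallingFactorial zero    = 1# ∷ []
  fallingFactorial (suc m) = fallingFactorial m ⊗ ((- fromℕ m) ∷ 1# ∷ [])

  binomial-t : ℕ → Poly
  binomial-t m = ((1/ (m !)) {{m ℕ.!≢0}}) ∙ fallingFactorial m

  -- f stands for ∑ᵤ f(u) Nᵤ
  WQSym* : ℕ → Set c
  WQSym* n = PackedWord n → Carrier

  infix 4 _≋_
  _≋_ : ∀ {n} → WQSym* n → WQSym* n → Set ℓ₁
  f ≋ g = ∀ w → f w ≈ g w

  N : ∀ {n} → PackedWord n → WQSym* n
  N u w = if does (u ≟ w) then 1# else 0#

  infixr 7 _•_
  _•_ : ∀ {n} → Carrier → WQSym* n → WQSym* n
  (a • f) w = a * f w

  ∑ : ∀ {n} {A : Set} → List A → (A → WQSym* n) → WQSym* n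
  ∑ xs f w = foldr (λ x s → f x w + s) 0# xs

  -- The bilinear extension of N u ⋆ N v = N (packBi u v)
  infixl 7 _⋆_
  _⋆_ : ∀ {n} → WQSym* n → WQSym* n → WQSym* n
  _⋆_ {n} f g = ∑ (packedWords n) λ u → ∑ (packedWords n) λ v → (f u * g v) • N (packBi u v)

  -- The coefficient of tᵏ in ∑ᵤ binom(t, max u) Nᵤ.  For n ≥ 1 only the powers
  -- 1 ≤ k ≤ n occur; E 0 0 is N of the empty word.
  E : ∀ n → ℕ → WQSym* n
  E n k = ∑ (packedWords n) λ u → coeff k (binomial-t (max u)) • N u

  𝐊 : ∀ {n} → PackedWord n → WQSym* n
  𝐊 {n} u = N u ⋆ E n (max u)

  -- (-1)^(max v - max u) / ∏ᵢ ℓᵢ(v,u), for v ≽ u; then max u ≤ max v, so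
  -- the truncated subtraction is the true one.
  expansionCoeff : ∀ {n} → PackedWord n → PackedWord n → Carrier
  expansionCoeff v u =
    (- 1#) ^ (max v ℕ.∸ max u) * (1/ blocksProduct v u) {{blocksProduct≢0 v u}}

{-# OPTIONS --safe #-}

-- The coefficient of N w in 𝐊 u is the coefficient of tʳ, r = max u, in the
-- sum of binom(t, max v) over the packed words v with packBi u v = w. There are
-- none unless w is finer than u. If it is, that sum equals ∏ᵢ binom(t, ℓᵢ(w,u)):
-- at t = m, both sides count the words x over {1,…,m} with packBi u (pack x) = w,
-- since such a word is an independent choice of ℓᵢ letters for every block i of
-- u, while m choose max v words x have pack x = v. Polynomials with equal values
-- at all natural numbers have equal coefficients in characteristic 0. Finally
-- binom(t, ℓ) has no constant term and linear term (-1)^(ℓ-1)/ℓ for ℓ ≥ 1, so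
-- the product over the r blocks has lowest term ∏ᵢ (-1)^(ℓᵢ-1)/ℓᵢ tʳ.

module Submission where

open import Defs
open import Data.Nat using (ℕ)
open import Algebra.Apartness.Bundles using (HeytingField)

open import Algebra.Bundles using (CommutativeRing)
import Algebra.Properties.Ring as RingProperties
import Algebra.Properties.Semiring.Exp as SemiringExp
import Algebra.Properties.Semiring.Mult as SemiringMult
import Algebra.Solver.Ring.NaturalCoefficients.Default as SemiringSolver
open import Data.Bool.Base using (true; false; if_then_else_)
open import Data.Fin.Base as Fin using (Fin; zero; suc; toℕ; fromℕ<)
import Data.Fin.Properties as Fin
open import Data.List.Base as List
  using (List; []; _∷_; allFin; concatMap; deduplicate; downFrom; filter; foldr; length; map; tabulate; upTo)
open import Data.List.Membership.Propositional using (find) renaming (_∈_ to _∈ₗ_)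
import Data.List.Membership.Propositional.Properties as ∈ₗ
open import Data.List.Membership.Propositional.Properties.WithK using (unique∧set⇒bag)
import Data.List.Properties as List
open import Data.List.Relation.Binary.BagAndSetEquality using (∼bag⇒↭)
open import Data.List.Relation.Binary.Permutation.Propositional.Properties using (↭-length)
open import Data.List.Relation.Unary.All as All using (All; []; _∷_)
import Data.List.Relation.Unary.All.Properties as All
open import Data.List.Relation.Unary.AllPairs as AllPairs using ([]; _∷_)
import Data.List.Relation.Unary.AllPairs.Properties as AllPairs
open import Data.List.Relation.Unary.Any as Any using (Any; here; there)
import Data.List.Relation.Unary.Any.Properties as Any
open import Data.List.Relation.Unary.Unique.Propositional using (Unique)
import Data.List.Relation.Unary.Unique.Propositional.Properties as Unique
import Data.List.Relation.Unary.Unique.DecPropositional.Properties as UniqueDec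
open import Data.Nat.Base as ℕ
  using (zero; suc; pred; _∸_; _≤_; _<_; z≤n; s≤s; s≤s⁻¹; NonZero; _!)
open import Data.Nat.Combinatorics using (_C_; nC1≡n; nCk+nC[k+1]≡[n+1]C[k+1])
open import Data.Nat.ListAction using (sum; product)
import Data.Nat.Properties as ℕ
open import Data.Nat.Solver using () renaming (module +-*-Solver to ℕSolver)
open import Data.Product.Base using (_×_; _,_; proj₁; proj₂; ∃-syntax)
open import Data.Product.Relation.Binary.Lex.NonStrict using (×-decTotalOrder)
open import Data.Sum.Base using (inj₁; inj₂)
open import Data.Vec.Base as Vec using (Vec; []; _∷_; lookup)
open import Data.Vec.Membership.Propositional using (_∈_)
import Data.Vec.Membership.Propositional.Properties as ∈
import Data.Vec.Properties as Vec
import Data.Vec.Relation.Unary.Any as VecAny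
import Data.Vec.Relation.Unary.Any.Properties as VecAny
open import Function.Base using (_∘_; const; id)
open import Function.Bundles using (_⇔_; mk⇔; module Equivalence)
open import Relation.Binary.Bundles using (DecTotalOrder)
open import Relation.Binary.Definitions using (DecidableEquality)
open import Relation.Binary.PropositionalEquality
  using (_≡_; _≢_; refl; sym; trans; cong; cong₂; subst; subst₂; ≢-sym; module ≡-Reasoning)
import Relation.Binary.Reasoning.Setoid as SetoidReasoning
open import Relation.Nullary.Decidable using (yes; no; does; dec-true; dec-false)
open import Relation.Nullary.Negation using (¬_; contradiction)
open import Relation.Unary using (Decidable)

open Equivalence using (to; from)

-- Counting in lists

length-unique : ∀ {A : Set} {xs ys : List A} → Unique xs → Unique ys →
                (∀ {x} → x ∈ₗ xs ⇔ x ∈ₗ ys) → length xs ≡ length ys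
length-unique xs! ys! eq = ↭-length (∼bag⇒↭ (unique∧set⇒bag xs! ys! eq))

length-concatMap : ∀ {A B : Set} (f : A → List B) xs →
                   length (concatMap f xs) ≡ sum (map (length ∘ f) xs)
length-concatMap f []       = refl
length-concatMap f (x ∷ xs) =
  trans (List.length-++ (f x)) (cong (length (f x) ℕ.+_) (length-concatMap f xs))

filter-map : ∀ {A B : Set} {P : B → Set} (P? : Decidable P) (f : A → B) xs →
             filter P? (map f xs) ≡ map f (filter (P? ∘ f) xs)
filter-map P? f []       = refl
filter-map P? f (x ∷ xs) with P? (f x)
... | yes _ = cong (f x ∷_) (filter-map P? f xs)
... | no  _ = filter-map P? f xs

module Counting {A : Set} (_≟_ : DecidableEquality A) where

  count : List A → A → ℕ
  count xs v = length (filter (_≟ v) xs)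

  count-≡ : ∀ x xs → count (x ∷ xs) x ≡ suc (count xs x)
  count-≡ x xs = cong length (List.filter-accept (_≟ x) refl)

  count-≢ : ∀ {x v} xs → x ≢ v → count (x ∷ xs) v ≡ count xs v
  count-≢ xs x≢v = cong length (List.filter-reject (_≟ _) x≢v)

  count-filter : ∀ {P : A → Set} (P? : Decidable P) {v} → P v → ∀ xs → count (filter P? xs) v ≡ count xs v
  count-filter P? Pv []       = refl
  count-filter P? {v} Pv (x ∷ xs) with x ≟ v
  ... | yes refl rewrite List.filter-accept P? {xs = xs} Pv =
    trans (count-≡ x (filter P? xs)) (cong suc (count-filter P? Pv xs))
  ... | no x≢v with P? x
  ...   | yes _ = trans (count-≢ (filter P? xs) x≢v) (count-filter P? Pv xs)
  ...   | no  _ = count-filter P? Pv xs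

  private
    sum-count-∷ : ∀ {x xs vs} → Unique vs → x ∈ₗ vs →
                  sum (map (count (x ∷ xs)) vs) ≡ suc (sum (map (count xs) vs))
    sum-count-∷ {x} {xs} (x≢vs ∷ _) (here refl) = cong₂ ℕ._+_ (count-≡ x xs)
      (cong sum (List.map-cong-local (All.map (count-≢ xs) x≢vs)))
    sum-count-∷ {x} {xs} {v ∷ vs} (v≢vs ∷ vs!) (there x∈) = trans
      (cong₂ ℕ._+_ (count-≢ xs λ x≡v → All.lookup v≢vs x∈ (sym x≡v)) (sum-count-∷ vs! x∈))
      (ℕ.+-suc _ _)

  sum-count : ∀ {xs vs} → Unique vs → All (_∈ₗ vs) xs → sum (map (count xs) vs) ≡ length xs
  sum-count {vs = vs} vs! [] = zeros vs
    where
    zeros : ∀ vs → sum (map (count []) vs) ≡ 0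
    zeros []       = refl
    zeros (_ ∷ vs) = zeros vs
  sum-count vs! (x∈ ∷ xs⊆) = trans (sum-count-∷ vs! x∈) (cong suc (sum-count vs! xs⊆))

open Counting

-- Chains

infixl 8 _[_≔_]
_[_≔_] : (ℕ → ℕ) → ℕ → ℕ → ℕ → ℕ
(b [ i ≔ c ]) j with i ℕ.≟ j
... | yes _ = c
... | no  _ = b j

[≔]-≡ : ∀ b i {c} → (b [ i ≔ c ]) i ≡ c
[≔]-≡ b i with i ℕ.≟ i
... | yes _   = refl
... | no  i≢i = contradiction refl i≢i

[≔]-≢ : ∀ b {i j c} → i ≢ j → (b [ i ≔ c ]) j ≡ b j
[≔]-≢ b {i} {j} i≢j with i ℕ.≟ j
... | yes i≡j = contradiction i≡j i≢j
... | no  _   = refl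

sum-*ˡ : ∀ k (f : ℕ → ℕ) cs → sum (map (λ c → k ℕ.* f c) cs) ≡ k ℕ.* sum (map f cs)
sum-*ˡ k f []       = sym (ℕ.*-zeroʳ k)
sum-*ˡ k f (c ∷ cs) = trans (cong (k ℕ.* f c ℕ.+_) (sum-*ˡ k f cs)) (sym (ℕ.*-distribˡ-+ k _ _))

sum-*ʳ : ∀ k (f : ℕ → ℕ) cs → sum (map (λ c → f c ℕ.* k) cs) ≡ sum (map f cs) ℕ.* k
sum-*ʳ k f []       = refl
sum-*ʳ k f (c ∷ cs) = trans (cong (f c ℕ.* k ℕ.+_) (sum-*ʳ k f cs)) (sym (ℕ.*-distribʳ-+ k (f c) _))

sum-product : ∀ {i is} (f : ℕ → ℕ → ℕ) (g : ℕ → ℕ) cs → Unique is → i ∈ₗ is →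
              (∀ c {j} → i ≢ j → f c j ≡ g j) → sum (map (λ c → f c i) cs) ≡ g i →
              sum (map (λ c → product (map (f c) is)) cs) ≡ product (map g is)
sum-product {i} {is = _ ∷ is} f g cs (i≢is ∷ _) (here refl) off on = begin
  sum (map (λ c → f c i ℕ.* product (map (f c) is)) cs)
    ≡⟨ cong sum (List.map-cong (λ c → cong (λ js → f c i ℕ.* product js)
         (List.map-cong-local (All.map (off c) i≢is))) cs) ⟩
  sum (map (λ c → f c i ℕ.* product (map g is)) cs)
    ≡⟨ sum-*ʳ (product (map g is)) (λ c → f c i) cs ⟩
  sum (map (λ c → f c i) cs) ℕ.* product (map g is)
    ≡⟨ cong (ℕ._* product (map g is)) on ⟩
  g i ℕ.* product (map g is) ∎
  where open ≡-Reasoning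
sum-product {i} {is = j ∷ is} f g cs (j≢is ∷ is!) (there i∈) off on = begin
  sum (map (λ c → f c j ℕ.* product (map (f c) is)) cs)
    ≡⟨ cong sum (List.map-cong (λ c → cong (ℕ._* product (map (f c) is))
         (off c λ i≡j → All.lookup j≢is i∈ (sym i≡j))) cs) ⟩
  sum (map (λ c → g j ℕ.* product (map (f c) is)) cs)
    ≡⟨ sum-*ˡ (g j) (λ c → product (map (f c) is)) cs ⟩
  g j ℕ.* sum (map (λ c → product (map (f c) is)) cs)
    ≡⟨ cong (g j ℕ.*_) (sum-product f g cs is! i∈ off on) ⟩
  g j ℕ.* product (map g is) ∎
  where open ≡-Reasoning

hockeyStick : ∀ n k → sum (map (_C k) (downFrom n)) ≡ n C suc k
hockeyStick zero    k = refl
hockeyStick (suc n) k = trans (cong (n C k ℕ.+_) (hockeyStick n k)) (nCk+nC[k+1]≡[n+1]C[k+1] n k)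

[1+k]*nC[1+k]+k*nCk≡n*nCk : ∀ n k → suc k ℕ.* (n C suc k) ℕ.+ k ℕ.* (n C k) ≡ n ℕ.* (n C k)
[1+k]*nC[1+k]+k*nCk≡n*nCk zero    zero    = refl
[1+k]*nC[1+k]+k*nCk≡n*nCk zero    (suc k) = cong₂ ℕ._+_ (ℕ.*-zeroʳ (2 ℕ.+ k)) (ℕ.*-zeroʳ (suc k))
[1+k]*nC[1+k]+k*nCk≡n*nCk (suc n) zero    =
  trans (ℕ.+-identityʳ _) (trans (ℕ.+-identityʳ _) (trans (nC1≡n (suc n)) (sym (ℕ.*-identityʳ _))))
[1+k]*nC[1+k]+k*nCk≡n*nCk (suc n) (suc k) = begin
  (2 ℕ.+ k) ℕ.* (suc n C (2 ℕ.+ k)) ℕ.+ suc k ℕ.* (suc n C suc k)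
    ≡⟨ cong₂ (λ x y → (2 ℕ.+ k) ℕ.* x ℕ.+ suc k ℕ.* y) (nCk+nC[k+1]≡[n+1]C[k+1] n (suc k)) (nCk+nC[k+1]≡[n+1]C[k+1] n k) ⟨
  (2 ℕ.+ k) ℕ.* (Q ℕ.+ R) ℕ.+ suc k ℕ.* (P ℕ.+ Q)
    ≡⟨ solve 4 (λ k P Q R → (con 2 :+ k) :* (Q :+ R) :+ (con 1 :+ k) :* (P :+ Q)
                         := ((con 1 :+ k) :* Q :+ k :* P) :+ ((con 2 :+ k) :* R :+ (con 1 :+ k) :* Q) :+ (P :+ Q))
         refl k P Q R ⟩
  (suc k ℕ.* Q ℕ.+ k ℕ.* P) ℕ.+ ((2 ℕ.+ k) ℕ.* R ℕ.+ suc k ℕ.* Q) ℕ.+ (P ℕ.+ Q)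
    ≡⟨ cong (ℕ._+ (P ℕ.+ Q)) (cong₂ ℕ._+_ ([1+k]*nC[1+k]+k*nCk≡n*nCk n k) ([1+k]*nC[1+k]+k*nCk≡n*nCk n (suc k))) ⟩
  n ℕ.* P ℕ.+ n ℕ.* Q ℕ.+ (P ℕ.+ Q)
    ≡⟨ solve 3 (λ n P Q → n :* P :+ n :* Q :+ (P :+ Q) := (con 1 :+ n) :* (P :+ Q)) refl n P Q ⟩
  suc n ℕ.* (P ℕ.+ Q)
    ≡⟨ cong (suc n ℕ.*_) (nCk+nC[k+1]≡[n+1]C[k+1] n k) ⟩
  suc n ℕ.* (suc n C suc k) ∎
  where
  open ≡-Reasoning
  open ℕSolver using (solve; con; _:+_; _:*_; _:=_)
  P = n C k
  Q = n C suc k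
  R = n C suc (suc k)

-- b i bounds the letters on the fibre of φ over i.
Chain : ∀ {K} → (Fin K → ℕ) → (ℕ → ℕ) → Vec ℕ K → Set
Chain φ b y = (∀ a → 1 ≤ lookup y a × lookup y a ≤ b (φ a)) ×
              (∀ {a a′} → a Fin.< a′ → φ a ≡ φ a′ → lookup y a′ < lookup y a)

chains : ∀ {K} → (Fin K → ℕ) → (ℕ → ℕ) → List (Vec ℕ K)
chains {zero}  φ b = [] ∷ []
chains {suc K} φ b =
  concatMap (λ c → map (suc c ∷_) (chains (φ ∘ suc) (b [ φ zero ≔ c ]))) (downFrom (b (φ zero)))

∈-chains⁺ : ∀ {K} {φ : Fin K → ℕ} {b y} → Chain φ b y → y ∈ₗ chains φ b
∈-chains⁺ {zero}  {y = []}    _ = here refl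
∈-chains⁺ {suc K} {φ} {b} {y = zero ∷ y} (bounds , _) = contradiction (proj₁ (bounds zero)) λ ()
∈-chains⁺ {suc K} {φ} {b} {y = suc c ∷ y} (bounds , dec) =
  ∈ₗ.∈-concatMap⁺ (λ c → map (suc c ∷_) (chains (φ ∘ suc) (b [ φ zero ≔ c ])))
    (Any.map (λ { refl → ∈ₗ.∈-map⁺ (suc c ∷_) (∈-chains⁺ (bounds′ , λ a<a′ → dec (s≤s a<a′))) })
             (∈ₗ.∈-downFrom⁺ (proj₂ (bounds zero))))
  where
  bounds′ : ∀ a → 1 ≤ lookup y a × lookup y a ≤ (b [ φ zero ≔ c ]) (φ (suc a))
  bounds′ a with φ zero ℕ.≟ φ (suc a)
  ... | yes eq = proj₁ (bounds (suc a)) , s≤s⁻¹ (dec (s≤s z≤n) eq)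
  ... | no  _  = bounds (suc a)

∈-chains⁻ : ∀ {K} {φ : Fin K → ℕ} {b y} → y ∈ₗ chains φ b → Chain φ b y
∈-chains⁻ {zero}  _ = (λ ()) , λ { {()} }
∈-chains⁻ {suc K} {φ} {b} y∈
  with c , c∈ , y∈′ ← find (∈ₗ.∈-concatMap⁻ (λ c → map (suc c ∷_) (chains (φ ∘ suc) (b [ φ zero ≔ c ])))
                         {xs = downFrom (b (φ zero))} y∈)
  with y′ , y′∈ , refl ← ∈ₗ.∈-map⁻ (suc c ∷_) y∈′
  with bounds , dec ← ∈-chains⁻ {φ = φ ∘ suc} y′∈ = bounds′ , dec′
  where
  bounds′ : ∀ a → 1 ≤ lookup (suc c ∷ y′) a × lookup (suc c ∷ y′) a ≤ b (φ a)
  bounds′ zero = s≤s z≤n , ∈ₗ.∈-downFrom⁻ c∈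
  bounds′ (suc a) with φ zero ℕ.≟ φ (suc a) | bounds a
  ... | yes eq | 1≤y , y≤c = 1≤y , ℕ.≤-trans y≤c (ℕ.<⇒≤ (subst (λ i → c < b i) eq (∈ₗ.∈-downFrom⁻ c∈)))
  ... | no  _  | bound     = bound

  dec′ : ∀ {a a′} → a Fin.< a′ → φ a ≡ φ a′ → lookup (suc c ∷ y′) a′ < lookup (suc c ∷ y′) a
  dec′ {zero}  {suc a′} _ eq with φ zero ℕ.≟ φ (suc a′) | bounds a′
  ... | yes _  | _ , y≤c = s≤s y≤c
  ... | no neq | _       = contradiction eq neq
  dec′ {suc a} {suc a′} a<a′ = dec (s≤s⁻¹ a<a′)

chains-unique : ∀ {K} (φ : Fin K → ℕ) b → Unique (chains φ b)
chains-unique {zero}  φ b = [] ∷ []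
chains-unique {suc K} φ b = Unique.concat⁺
  (All.map⁺ (All.universal (λ c → Unique.map⁺ {f = suc c ∷_} Vec.∷-injectiveʳ
    (chains-unique (φ ∘ suc) (b [ φ zero ≔ c ]))) (downFrom (b (φ zero)))))
  (AllPairs.map⁺ (AllPairs.map (λ c≢c′ {v} → disjoint c≢c′ {v = v}) (Unique.downFrom⁺ (b (φ zero)))))
  where
  disjoint : ∀ {c c′} → c ≢ c′ → {ys ys′ : List (Vec ℕ K)} →
             ∀ {v} → ¬ (v ∈ₗ map (suc c ∷_) ys × v ∈ₗ map (suc c′ ∷_) ys′)
  disjoint c≢c′ (y∈ , y∈′) with ∈ₗ.∈-map⁻ _ y∈ | ∈ₗ.∈-map⁻ _ y∈′
  ... | _ , _ , refl | _ , _ , eq = c≢c′ (ℕ.suc-injective (Vec.∷-injectiveˡ eq))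

length-chains : ∀ {K} (φ : Fin K → ℕ) b {is} → Unique is → (∀ a → φ a ∈ₗ is) →
                length (chains φ b) ≡ product (map (λ i → b i C count ℕ._≟_ (tabulate φ) i) is)
length-chains {zero} φ b {is} _ _ = sym (ones is)
  where
  ones : ∀ is → product (map (λ i → b i C 0) is) ≡ 1
  ones []       = refl
  ones (_ ∷ is) = trans (ℕ.+-identityʳ _) (ones is)
length-chains {suc K} φ b {is} is! φ∈ = begin
  length (chains φ b)
    ≡⟨ length-concatMap _ (downFrom (b i₀)) ⟩
  sum (map (λ c → length (map (suc c ∷_) (chains (φ ∘ suc) (b [ i₀ ≔ c ])))) (downFrom (b i₀)))
    ≡⟨ cong sum (List.map-cong (λ c → trans (List.length-map (suc c ∷_) (chains (φ ∘ suc) (b [ i₀ ≔ c ])))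
         (length-chains (φ ∘ suc) (b [ i₀ ≔ c ]) is! (φ∈ ∘ suc))) (downFrom (b i₀))) ⟩
  sum (map (λ c → product (map (λ i → (b [ i₀ ≔ c ]) i C count ℕ._≟_ (tabulate (φ ∘ suc)) i) is)) (downFrom (b i₀)))
    ≡⟨ sum-product (λ c i → (b [ i₀ ≔ c ]) i C count ℕ._≟_ (tabulate (φ ∘ suc)) i) _ (downFrom (b i₀)) is! (φ∈ zero)
         (λ c i₀≢j → cong₂ _C_ ([≔]-≢ b i₀≢j) (sym (count-≢ ℕ._≟_ (tabulate (φ ∘ suc)) i₀≢j)))
         (begin
            sum (map (λ c → (b [ i₀ ≔ c ]) i₀ C k) (downFrom (b i₀)))
              ≡⟨ cong sum (List.map-cong (λ c → cong (_C k) ([≔]-≡ b i₀)) (downFrom (b i₀))) ⟩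
            sum (map (_C k) (downFrom (b i₀)))
              ≡⟨ hockeyStick (b i₀) k ⟩
            b i₀ C suc k
              ≡⟨ cong (b i₀ C_) (count-≡ ℕ._≟_ i₀ (tabulate (φ ∘ suc))) ⟨
            b i₀ C count ℕ._≟_ (tabulate φ) i₀ ∎) ⟩
  product (map (λ i → b i C count ℕ._≟_ (tabulate φ) i) is) ∎
  where
  open ≡-Reasoning
  i₀ = φ zero
  k  = count ℕ._≟_ (tabulate (φ ∘ suc)) i₀

-- Words ordered like a given packed word on each colour class

words-unique : ∀ m n → Unique (words m n)
words-unique m zero    = [] ∷ []
words-unique m (suc n) = Unique.cartesianProductWith⁺ _∷_ Vec.∷-injective
  (Unique.map⁺ ℕ.suc-injective (Unique.upTo⁺ m)) (words-unique m n)

∈-words : ∀ m {n} {x : Vec ℕ n} → x ∈ₗ words m n ⇔ (∀ i → 1 ≤ lookup x i × lookup x i ≤ m)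
∈-words m = mk⇔ bounds (mem _)
  where
  mem : ∀ {n} (x : Vec ℕ n) → (∀ i → 1 ≤ lookup x i × lookup x i ≤ m) → x ∈ₗ words m n
  mem []          _ = here refl
  mem (zero  ∷ x) p = contradiction (proj₁ (p zero)) λ ()
  mem (suc a ∷ x) p = ∈ₗ.∈-cartesianProductWith⁺ _∷_
    (∈ₗ.∈-map⁺ suc (∈ₗ.∈-upTo⁺ (proj₂ (p zero)))) (mem x (p ∘ suc))

  bounds : ∀ {n} {x : Vec ℕ n} → x ∈ₗ words m n → ∀ i → 1 ≤ lookup x i × lookup x i ≤ m
  bounds {suc n} x∈ i
    with a , x′ , a∈ , x′∈ , refl ← ∈ₗ.∈-cartesianProductWith⁻ _∷_ (map suc (upTo m)) (words m n) x∈
    with c , c∈ , refl ← ∈ₗ.∈-map⁻ suc a∈ | i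
  ... | zero  = s≤s z≤n , ∈ₗ.∈-upTo⁻ c∈
  ... | suc i = bounds x′∈ i

letter-bounds : ∀ {n} (w : PackedWord n) i → 1 ≤ lookup (word w) i × lookup (word w) i ≤ max w
letter-bounds w i = to (packed⇒max (packedProof w) _) (∈.∈-lookup i (word w))

module _ {n} (w : PackedWord n) where

  private
    K = max w

    letter∈ : (a : Fin K) → K ∸ toℕ a ∈ word w
    letter∈ a = from (packed⇒max (packedProof w) _) (ℕ.m<n⇒0<n∸m (Fin.toℕ<n a) , ℕ.m∸n≤m K (toℕ a))

    rank< : ∀ j → K ∸ lookup (word w) j < K
    rank< j = ℕ.∸-monoʳ-< (proj₁ (letter-bounds w j)) (proj₂ (letter-bounds w j))

  -- The largest letter has rank 0, because chains start with the largest letter.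
  rank : Fin n → Fin K
  rank j = fromℕ< (rank< j)

  position : Fin K → Fin n
  position a = VecAny.index (letter∈ a)

  lookup-position : ∀ a → lookup (word w) (position a) ≡ K ∸ toℕ a
  lookup-position a = sym (VecAny.lookup-index (letter∈ a))

  toℕ-rank : ∀ j → toℕ (rank j) ≡ K ∸ lookup (word w) j
  toℕ-rank j = Fin.toℕ-fromℕ< (rank< j)

  rank-position : ∀ a → rank (position a) ≡ a
  rank-position a = Fin.toℕ-injective (trans (toℕ-rank (position a))
    (trans (cong (K ∸_) (lookup-position a)) (ℕ.m∸[m∸n]≡n (Fin.toℕ≤n a))))

  position-rank : ∀ j → lookup (word w) (position (rank j)) ≡ lookup (word w) j
  position-rank j = trans (lookup-position (rank j))
    (trans (cong (K ∸_) (toℕ-rank j)) (ℕ.m∸[m∸n]≡n (proj₂ (letter-bounds w j))))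

  position-injective : ∀ {a a′} → lookup (word w) (position a) ≡ lookup (word w) (position a′) → a ≡ a′
  position-injective {a} {a′} eq = trans (sym (rank-position a)) (trans
    (Fin.toℕ-injective (trans (toℕ-rank _) (trans (cong (K ∸_) eq) (sym (toℕ-rank _)))))
    (rank-position a′))

  rank-antimono : ∀ {i j} → lookup (word w) i ≤ lookup (word w) j ⇔ toℕ (rank j) ≤ toℕ (rank i)
  rank-antimono {i} {j} = mk⇔
    (λ i≤j → subst₂ _≤_ (sym (toℕ-rank j)) (sym (toℕ-rank i)) (ℕ.∸-monoʳ-≤ K i≤j))
    (λ j≤i → ℕ.∸-cancelʳ-≤ (proj₂ (letter-bounds w i)) (subst₂ _≤_ (toℕ-rank j) (toℕ-rank i) j≤i))

OrderedLike : ∀ {n} → (Fin n → ℕ) → PackedWord n → Vec ℕ n → Set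
OrderedLike c w x = ∀ i j → c i ≡ c j → lookup x i ≤ lookup x j ⇔ lookup (word w) i ≤ lookup (word w) j

module _ {n} (w : PackedWord n) (c : Fin n → ℕ)
         (c-resp : ∀ i j → lookup (word w) i ≤ lookup (word w) j → c i ≤ c j) where

  colour : Fin (max w) → ℕ
  colour a = c (position w a)

  colour-rank : ∀ j → colour (rank w j) ≡ c j
  colour-rank j = ℕ.≤-antisym (c-resp _ _ (ℕ.≤-reflexive (position-rank w j)))
                              (c-resp _ _ (ℕ.≤-reflexive (sym (position-rank w j))))

  private
    ofChain : Vec ℕ (max w) → Vec ℕ n
    ofChain y = Vec.tabulate (lookup y ∘ rank w)

    ofChain-injective : ∀ {y y′} → ofChain y ≡ ofChain y′ → y ≡ y′
    ofChain-injective {y} {y′} eq = trans (sym (Vec.tabulate∘lookup y))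
      (trans (Vec.tabulate-cong λ a → subst (λ b → lookup y b ≡ lookup y′ b) (rank-position w a) (begin
        lookup y (rank w (position w a))
          ≡⟨ Vec.lookup∘tabulate (lookup y ∘ rank w) (position w a) ⟨
        lookup (ofChain y) (position w a)
          ≡⟨ cong (λ x → lookup x (position w a)) eq ⟩
        lookup (ofChain y′) (position w a)
          ≡⟨ Vec.lookup∘tabulate (lookup y′ ∘ rank w) (position w a) ⟩
        lookup y′ (rank w (position w a)) ∎))
      (Vec.tabulate∘lookup y′))
      where open ≡-Reasoning

    ofChain-ordered : ∀ {b y} → Chain colour b y → OrderedLike c w (ofChain y)
    ofChain-ordered {y = y} (_ , dec) i j ci≡cj =
      subst₂ (λ s t → s ≤ t ⇔ lookup (word w) i ≤ lookup (word w) j)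
        (sym (Vec.lookup∘tabulate _ i)) (sym (Vec.lookup∘tabulate _ j))
        (mk⇔ reflects preserves)
      where
      same : colour (rank w i) ≡ colour (rank w j)
      same = trans (colour-rank i) (trans ci≡cj (sym (colour-rank j)))

      preserves : lookup (word w) i ≤ lookup (word w) j → lookup y (rank w i) ≤ lookup y (rank w j)
      preserves i≤j with ℕ.m≤n⇒m<n∨m≡n (to (rank-antimono w {i} {j}) i≤j)
      ... | inj₁ rj<ri = ℕ.<⇒≤ (dec rj<ri (sym same))
      ... | inj₂ rj≡ri = ℕ.≤-reflexive (cong (lookup y) (sym (Fin.toℕ-injective rj≡ri)))

      reflects : lookup y (rank w i) ≤ lookup y (rank w j) → lookup (word w) i ≤ lookup (word w) j
      reflects yi≤yj = from (rank-antimono w {i} {j}) (ℕ.≮⇒≥ λ ri<rj →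
        ℕ.<⇒≱ (dec ri<rj same) yi≤yj)

    toChain : ∀ {m x} → (∀ i → 1 ≤ lookup x i × lookup x i ≤ m) → OrderedLike c w x →
              ∃[ y ] (Chain colour (const m) y × x ≡ ofChain y)
    toChain {m} {x} bounds ord = y , ((λ a → subst (λ l → 1 ≤ l × l ≤ m) (sym (y-at a)) (bounds _)) , dec) ,
      trans (sym (Vec.tabulate∘lookup x)) (Vec.tabulate-cong λ j → trans (x-at j) (sym (y-at (rank w j))))
      where
      y = Vec.tabulate (lookup x ∘ position w)

      y-at : ∀ a → lookup y a ≡ lookup x (position w a)
      y-at = Vec.lookup∘tabulate (lookup x ∘ position w)

      x-at : ∀ j → lookup x j ≡ lookup x (position w (rank w j))
      x-at j = ℕ.≤-antisym
        (from (ord _ _ (sym (colour-rank j))) (ℕ.≤-reflexive (sym (position-rank w j))))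
        (from (ord _ _ (colour-rank j)) (ℕ.≤-reflexive (position-rank w j)))

      dec : ∀ {a a′} → a Fin.< a′ → colour a ≡ colour a′ → lookup y a′ < lookup y a
      dec {a} {a′} a<a′ same = ℕ.≰⇒> λ ya≤ya′ → ℕ.<⇒≱ a<a′
        (subst₂ (λ s t → toℕ s ≤ toℕ t) (rank-position w a′) (rank-position w a)
          (to (rank-antimono w {position w a} {position w a′})
            (to (ord _ _ same) (subst₂ _≤_ (y-at a) (y-at a′) ya≤ya′))))

  length-orderedLike : ∀ {m xs is} → Unique xs →
    (∀ {x} → x ∈ₗ xs ⇔ ((∀ i → 1 ≤ lookup x i × lookup x i ≤ m) × OrderedLike c w x)) →
    Unique is → (∀ a → colour a ∈ₗ is) →
    length xs ≡ product (map (λ i → m C count ℕ._≟_ (tabulate colour) i) is)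
  length-orderedLike {m} {xs} {is} xs! xs⇔ is! c∈is = begin
    length xs
      ≡⟨ length-unique xs! (Unique.map⁺ ofChain-injective (chains-unique colour (const m))) (mk⇔ fwd bwd) ⟩
    length (map ofChain (chains colour (const m)))
      ≡⟨ List.length-map ofChain (chains colour (const m)) ⟩
    length (chains colour (const m))
      ≡⟨ length-chains colour (const m) is! c∈is ⟩
    product (map (λ i → m C count ℕ._≟_ (tabulate colour) i) is) ∎
    where
    open ≡-Reasoning

    fwd : ∀ {x} → x ∈ₗ xs → x ∈ₗ map ofChain (chains colour (const m))
    fwd {x} x∈ with bounds , ord ← to xs⇔ x∈ with y , chain , refl ← toChain {x = x} bounds ord =
      ∈ₗ.∈-map⁺ ofChain (∈-chains⁺ {y = y} chain)

    bwd : ∀ {x} → x ∈ₗ map ofChain (chains colour (const m)) → x ∈ₗ xs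
    bwd x∈ with y , y∈ , refl ← ∈ₗ.∈-map⁻ ofChain x∈ with chain ← ∈-chains⁻ {φ = colour} y∈ =
      from xs⇔ ((λ i → subst (λ l → 1 ≤ l × l ≤ m) (sym (Vec.lookup∘tabulate _ i)) (proj₁ chain (rank w i)))
               , ofChain-ordered {y = y} chain)

blocksIn≡count : ∀ {n} (u w : PackedWord n) (w≽u : w ≽ u) i →
                 blocksIn i w u ≡ count ℕ._≟_ (tabulate (colour w (lookup (word u)) w≽u)) i
blocksIn≡count {n} u w w≽u i = begin
  blocksIn i w u
    ≡⟨ length-unique (UniqueDec.deduplicate-! ℕ._≟_ _)
         (Unique.map⁺ (position-injective w) (Unique.filter⁺ (λ a → φ a ℕ.≟ i) (Unique.allFin⁺ (max w))))
         (mk⇔ fwd bwd) ⟩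
  length (map letter (filter (λ a → φ a ℕ.≟ i) (allFin (max w))))
    ≡⟨ List.length-map letter (filter (λ a → φ a ℕ.≟ i) (allFin (max w))) ⟩
  length (filter (λ a → φ a ℕ.≟ i) (allFin (max w)))
    ≡⟨ List.length-map φ (filter (λ a → φ a ℕ.≟ i) (allFin (max w))) ⟨
  length (map φ (filter (λ a → φ a ℕ.≟ i) (allFin (max w))))
    ≡⟨ cong length (filter-map (ℕ._≟ i) φ (allFin (max w))) ⟨
  count ℕ._≟_ (map φ (allFin (max w))) i
    ≡⟨ cong (λ ls → count ℕ._≟_ ls i) (List.map-tabulate id φ) ⟩
  count ℕ._≟_ (tabulate φ) i ∎
  where
  open ≡-Reasoning
  φ      = colour w (lookup (word u)) w≽u
  letter : Fin (max w) → ℕ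
  letter = lookup (word w) ∘ position w
  js     = filter (λ j → lookup (word u) j ℕ.≟ i) (allFin n)

  fwd : ∀ {l} → l ∈ₗ deduplicate ℕ._≟_ (map (lookup (word w)) js) →
        l ∈ₗ map letter (filter (λ a → φ a ℕ.≟ i) (allFin (max w)))
  fwd l∈ with j , j∈ , refl ← ∈ₗ.∈-map⁻ (lookup (word w)) (∈ₗ.∈-deduplicate⁻ ℕ._≟_ _ l∈)
         with _ , uj≡i ← ∈ₗ.∈-filter⁻ (λ j → lookup (word u) j ℕ.≟ i) {xs = allFin n} j∈ =
    subst (_∈ₗ _) (position-rank w j) (∈ₗ.∈-map⁺ letter
      (∈ₗ.∈-filter⁺ (λ a → φ a ℕ.≟ i) (∈ₗ.∈-allFin (rank w j)) (trans (colour-rank w _ w≽u j) uj≡i)))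

  bwd : ∀ {l} → l ∈ₗ map letter (filter (λ a → φ a ℕ.≟ i) (allFin (max w))) →
        l ∈ₗ deduplicate ℕ._≟_ (map (lookup (word w)) js)
  bwd l∈ with a , a∈ , refl ← ∈ₗ.∈-map⁻ letter l∈
         with _ , φa≡i ← ∈ₗ.∈-filter⁻ (λ a → φ a ℕ.≟ i) {xs = allFin (max w)} a∈ =
    ∈ₗ.∈-deduplicate⁺ ℕ._≟_ (∈ₗ.∈-map⁺ (lookup (word w))
      (∈ₗ.∈-filter⁺ (λ j → lookup (word u) j ℕ.≟ i) (∈ₗ.∈-allFin (position w a)) φa≡i))

-- Packing

module PackingOrder {c ℓ₁ ℓ₂} (A : DecTotalOrder c ℓ₁ ℓ₂) where

  private module A = DecTotalOrder A
  open A using (_≤?_) renaming (_≤_ to _⊑_)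
  open Packing A

  countBelow-mono : ∀ bs {a b} → a ⊑ b → countBelow bs a ≤ countBelow bs b
  countBelow-mono []       a⊑b = z≤n
  countBelow-mono (x ∷ bs) {a} {b} a⊑b with x ≤? a | x ≤? b
  ... | yes _   | yes _   = s≤s (countBelow-mono bs a⊑b)
  ... | yes x⊑a | no  x⋢b = contradiction (A.trans x⊑a a⊑b) x⋢b
  ... | no  _   | yes _   = ℕ.m≤n⇒m≤1+n (countBelow-mono bs a⊑b)
  ... | no  _   | no  _   = countBelow-mono bs a⊑b

  countBelow-strict : ∀ {bs a b} → Any (A._≈ b) bs → ¬ (b ⊑ a) → a ⊑ b →
                      countBelow bs a < countBelow bs b
  countBelow-strict {x ∷ bs} {a} {b} b∈ b⋢a a⊑b with x ≤? a | x ≤? b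
  countBelow-strict (here x≈b)          b⋢a a⊑b | yes x⊑a | _ =
    contradiction (A.trans (A.reflexive (A.Eq.sym x≈b)) x⊑a) b⋢a
  countBelow-strict (here x≈b)          b⋢a a⊑b | no _    | no x⋢b = contradiction (A.reflexive x≈b) x⋢b
  countBelow-strict {x ∷ bs} (here x≈b) b⋢a a⊑b | no _    | yes _  = s≤s (countBelow-mono bs a⊑b)
  countBelow-strict (there b∈)          b⋢a a⊑b | yes _   | yes _  = s≤s (countBelow-strict b∈ b⋢a a⊑b)
  countBelow-strict (there b∈)          b⋢a a⊑b | yes x⊑a | no x⋢b = contradiction (A.trans x⊑a a⊑b) x⋢b
  countBelow-strict (there b∈)          b⋢a a⊑b | no _    | yes _  = ℕ.m≤n⇒m≤1+n (countBelow-strict b∈ b⋢a a⊑b)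
  countBelow-strict (there b∈)          b⋢a a⊑b | no _    | no _   = countBelow-strict b∈ b⋢a a⊑b

  pack-order : ∀ {n} (z : Vec A.Carrier n) i j →
               lookup (word (pack z)) i ≤ lookup (word (pack z)) j ⇔ lookup z i ⊑ lookup z j
  pack-order z i j = subst₂ (λ s t → s ≤ t ⇔ lookup z i ⊑ lookup z j)
    (sym (Vec.lookup-map i _ z)) (sym (Vec.lookup-map j _ z)) (mk⇔ reflects (countBelow-mono bs))
    where
    bs = distinctLetters z

    occurs : Any (A._≈ lookup z i) bs
    occurs = Any.deduplicate⁺ A._≟_ (λ y≈z z≈x → A.Eq.trans y≈z z≈x)
      (Any.map (λ { refl → A.Eq.refl }) (∈.∈-toList⁺ (∈.∈-lookup i z)))

    reflects : countBelow bs (lookup z i) ≤ countBelow bs (lookup z j) → lookup z i ⊑ lookup z j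
    reflects ci≤cj with lookup z i ≤? lookup z j | A.total (lookup z i) (lookup z j)
    ... | yes zi⊑zj | _          = zi⊑zj
    ... | no  _     | inj₁ zi⊑zj = zi⊑zj
    ... | no  zi⋢zj | inj₂ zj⊑zi = contradiction ci≤cj (ℕ.<⇒≱ (countBelow-strict occurs zi⋢zj zj⊑zi))

-- The letter below vᵢ occurs in v, at a position where w has a letter below wᵢ.
≽⇒lookup-≤ : ∀ {n} (v w : PackedWord n) → w ≽ v → ∀ i → lookup (word v) i ≤ lookup (word w) i
≽⇒lookup-≤ v w w≽v i = go _ i refl
  where
  go : ∀ l i → lookup (word v) i ≡ l → l ≤ lookup (word w) i
  go zero          i vi≡l = z≤n
  go (suc zero)    i vi≡l = proj₁ (letter-bounds w i)
  go (suc (suc l)) i vi≡l = ℕ.≤-<-trans (go (suc l) j vj≡) (ℕ.≰⇒> λ wi≤wj →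
    ℕ.<⇒≱ (ℕ.n<1+n (suc l)) (subst₂ _≤_ vi≡l vj≡ (w≽v i j wi≤wj)))
    where
    l∈ : suc l ∈ word v
    l∈ = from (packed⇒max (packedProof v) _)
      (s≤s z≤n , ℕ.≤-trans (ℕ.n≤1+n (suc l)) (subst (_≤ max v) vi≡l (proj₂ (letter-bounds v i))))
    j = VecAny.index l∈
    vj≡ : lookup (word v) j ≡ suc l
    vj≡ = sym (VecAny.lookup-index l∈)

≽-antisym : ∀ {n} {v w : PackedWord n} → v ≽ w → w ≽ v → v ≡ w
≽-antisym {v = v} {w} v≽w w≽v = word-injective (begin
  word v                        ≡⟨ Vec.tabulate∘lookup (word v) ⟨
  Vec.tabulate (lookup (word v)) ≡⟨ Vec.tabulate-cong (λ i → ℕ.≤-antisym (≽⇒lookup-≤ v w w≽v i) (≽⇒lookup-≤ w v v≽w i)) ⟩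
  Vec.tabulate (lookup (word w)) ≡⟨ Vec.tabulate∘lookup (word w) ⟩
  word w                        ∎)
  where open ≡-Reasoning

open Packing ℕ.≤-decTotalOrder using (pack)
open PackingOrder ℕ.≤-decTotalOrder using (pack-order)

pack≡⇔orderedLike : ∀ {n} {w : PackedWord n} {x} → pack x ≡ w ⇔ OrderedLike (const 0) w x
pack≡⇔orderedLike {w = w} {x} = mk⇔
  (λ { refl i j _ → mk⇔ (from (pack-order x i j)) (to (pack-order x i j)) })
  (λ ord → ≽-antisym (λ i j → to (ord i j refl) ∘ to (pack-order x i j))
                     (λ i j → from (pack-order x i j) ∘ from (ord i j refl)))

module _ {n} (u v w : PackedWord n) where

  private
    biword : Vec (ℕ × ℕ) n
    biword = Vec.zip (word u) (word v)

    open DecTotalOrder (×-decTotalOrder ℕ.≤-decTotalOrder ℕ.≤-decTotalOrder)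
      using () renaming (_≤_ to _≤ₗₑₓ_)

    packBi-order : ∀ i j → lookup (word (packBi u v)) i ≤ lookup (word (packBi u v)) j ⇔
                           (lookup (word u) i , lookup (word v) i) ≤ₗₑₓ (lookup (word u) j , lookup (word v) j)
    packBi-order i j = subst₂ (λ s t → lookup (word (packBi u v)) i ≤ lookup (word (packBi u v)) j ⇔ s ≤ₗₑₓ t)
      (Vec.lookup-zip i (word u) (word v)) (Vec.lookup-zip j (word u) (word v))
      (PackingOrder.pack-order (×-decTotalOrder ℕ.≤-decTotalOrder ℕ.≤-decTotalOrder) biword i j)

  packBi≡⇒≽ : packBi u v ≡ w → w ≽ u
  packBi≡⇒≽ refl i j wi≤wj with to (packBi-order i j) wi≤wj
  ... | inj₁ (ui≤uj , _) = ui≤uj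
  ... | inj₂ (ui≡uj , _) = ℕ.≤-reflexive ui≡uj

  packBi≡⇔orderedLike : w ≽ u → packBi u v ≡ w ⇔ OrderedLike (lookup (word u)) w (word v)
  packBi≡⇔orderedLike w≽u = mk⇔ fwd λ ord →
    ≽-antisym (λ i j → below ord i j ∘ to (packBi-order i j)) (λ i j → from (packBi-order i j) ∘ above ord i j)
    where
    fwd : packBi u v ≡ w → OrderedLike (lookup (word u)) w (word v)
    fwd refl i j ui≡uj = mk⇔ (λ vi≤vj → from (packBi-order i j) (inj₂ (ui≡uj , vi≤vj))) vs
      where
      vs : lookup (word (packBi u v)) i ≤ lookup (word (packBi u v)) j → lookup (word v) i ≤ lookup (word v) j
      vs wi≤wj with to (packBi-order i j) wi≤wj
      ... | inj₁ (_ , ui≢uj) = contradiction ui≡uj ui≢uj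
      ... | inj₂ (_ , vi≤vj) = vi≤vj

    module _ (ord : OrderedLike (lookup (word u)) w (word v)) where
      below : ∀ i j → (lookup (word u) i , lookup (word v) i) ≤ₗₑₓ (lookup (word u) j , lookup (word v) j) →
              lookup (word w) i ≤ lookup (word w) j
      below i j (inj₁ (ui≤uj , ui≢uj)) with ℕ.≤-total (lookup (word w) i) (lookup (word w) j)
      ... | inj₁ wi≤wj = wi≤wj
      ... | inj₂ wj≤wi = contradiction (ℕ.≤-antisym ui≤uj (w≽u j i wj≤wi)) ui≢uj
      below i j (inj₂ (ui≡uj , vi≤vj)) = to (ord i j ui≡uj) vi≤vj

      above : ∀ i j → lookup (word w) i ≤ lookup (word w) j →
              (lookup (word u) i , lookup (word v) i) ≤ₗₑₓ (lookup (word u) j , lookup (word v) j)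
      above i j wi≤wj with lookup (word u) i ℕ.≟ lookup (word u) j
      ... | yes ui≡uj = inj₂ (ui≡uj , from (ord i j ui≡uj) wi≤wj)
      ... | no  ui≢uj = inj₁ (w≽u i j wi≤wj , ui≢uj)

orderedLike-pack : ∀ {n} {c : Fin n → ℕ} {w x} → OrderedLike c w (word (pack x)) ⇔ OrderedLike c w x
orderedLike-pack {x = x} = mk⇔
  (λ ord i j ci≡cj → mk⇔ (to (ord i j ci≡cj) ∘ from (pack-order x i j)) (to (pack-order x i j) ∘ from (ord i j ci≡cj)))
  (λ ord i j ci≡cj → mk⇔ (to (ord i j ci≡cj) ∘ to (pack-order x i j)) (from (pack-order x i j) ∘ from (ord i j ci≡cj)))

length-pack≡ : ∀ m {n} (v : PackedWord n) → length (filter (λ x → pack x ≟ v) (words m n)) ≡ m C max v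
length-pack≡ m {n} v = begin
  length (filter (λ x → pack x ≟ v) (words m n))
    ≡⟨ length-orderedLike v (const 0) (λ _ _ _ → z≤n) (Unique.filter⁺ (λ x → pack x ≟ v) (words-unique m n))
         (mk⇔ (λ x∈ → let (x∈words , eq) = ∈ₗ.∈-filter⁻ (λ x → pack x ≟ v) {xs = words m n} x∈
                       in to (∈-words m) x∈words , to pack≡⇔orderedLike eq)
              (λ (bounds , ord) → ∈ₗ.∈-filter⁺ (λ x → pack x ≟ v) (from (∈-words m) bounds) (from pack≡⇔orderedLike ord)))
         ([] ∷ []) (λ _ → here refl) ⟩
  (m C count ℕ._≟_ zeros 0) ℕ.* 1
    ≡⟨ ℕ.*-identityʳ _ ⟩
  m C count ℕ._≟_ zeros 0
    ≡⟨ cong (m C_) (trans (cong length (List.filter-all (ℕ._≟ 0) {xs = zeros} (All.tabulate⁺ λ _ → refl))) (List.length-tabulate {n = max v} (const 0))) ⟩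
  m C max v ∎
  where
  open ≡-Reasoning
  zeros : List ℕ
  zeros = tabulate {n = max v} (const 0)

letters : ∀ {n} → PackedWord n → List ℕ
letters u = map suc (upTo (max u))

module _ {n} (u w : PackedWord n) where

  refinedBy : List (PackedWord n)
  refinedBy = filter (λ v → packBi u v ≟ w) (packedWords n)

  module _ (w≽u : w ≽ u) where

    private
      c = lookup (word u)
      Q? = λ v → packBi u v ≟ w

      letters! : Unique (letters u)
      letters! = Unique.map⁺ ℕ.suc-injective (Unique.upTo⁺ (max u))

      colour∈ : ∀ a → colour w c w≽u a ∈ₗ letters u
      colour∈ a with letter-bounds u (position w a)
      ... | 1≤l , l≤r with c (position w a)
      ...   | suc l = ∈ₗ.∈-map⁺ suc (∈ₗ.∈-upTo⁺ l≤r)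

    sum-binomial : ∀ m → sum (map (λ v → m C max v) refinedBy) ≡
                         product (map (λ i → m C blocksIn i w u) (letters u))
    sum-binomial m = begin
      sum (map (λ v → m C max v) refinedBy)
        ≡⟨ cong sum (List.map-cong-local (All.map count-packs (All.all-filter Q? (packedWords n)))) ⟨
      sum (map (count _≟_ (filter Q? packs)) refinedBy)
        ≡⟨ sum-count _≟_ (Unique.filter⁺ Q? (packedWords-unique n)) (All.map refined (All.all-filter Q? packs)) ⟩
      length (filter Q? packs)
        ≡⟨ cong length (filter-map Q? pack (words m n)) ⟩
      length (map pack ws)
        ≡⟨ List.length-map pack ws ⟩
      length ws
        ≡⟨ length-orderedLike w c w≽u (Unique.filter⁺ (Q? ∘ pack) (words-unique m n)) ws⇔ letters! colour∈ ⟩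
      product (map (λ i → m C count ℕ._≟_ (tabulate (colour w c w≽u)) i) (letters u))
        ≡⟨ cong product (List.map-cong (λ i → cong (m C_) (sym (blocksIn≡count u w w≽u i))) (letters u)) ⟩
      product (map (λ i → m C blocksIn i w u) (letters u)) ∎
      where
      open ≡-Reasoning
      packs = map pack (words m n)
      ws    = filter (Q? ∘ pack) (words m n)

      count-packs : ∀ {v} → packBi u v ≡ w → count _≟_ (filter Q? packs) v ≡ m C max v
      count-packs {v} eq = begin
        count _≟_ (filter Q? packs) v
          ≡⟨ count-filter _≟_ Q? eq packs ⟩
        count _≟_ packs v
          ≡⟨ cong length (filter-map (_≟ v) pack (words m n)) ⟩
        length (map pack (filter (λ x → pack x ≟ v) (words m n)))
          ≡⟨ List.length-map pack (filter (λ x → pack x ≟ v) (words m n)) ⟩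
        length (filter (λ x → pack x ≟ v) (words m n))
          ≡⟨ length-pack≡ m v ⟩
        m C max v ∎

      refined : ∀ {v} → packBi u v ≡ w → v ∈ₗ refinedBy
      refined eq = ∈ₗ.∈-filter⁺ Q? (packedWords-complete _) eq

      ws⇔ : ∀ {x} → x ∈ₗ ws ⇔ ((∀ i → 1 ≤ lookup x i × lookup x i ≤ m) × OrderedLike c w x)
      ws⇔ {x} = mk⇔
        (λ x∈ → let (x∈words , eq) = ∈ₗ.∈-filter⁻ (Q? ∘ pack) {xs = words m n} x∈
                 in to (∈-words m) x∈words , to (orderedLike-pack {w = w} {x = x}) (to (packBi≡⇔orderedLike u (pack x) w w≽u) eq))
        (λ (bounds , ord) → ∈ₗ.∈-filter⁺ (Q? ∘ pack) (from (∈-words m) bounds)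
           (from (packBi≡⇔orderedLike u (pack x) w w≽u) (from (orderedLike-pack {w = w} {x = x}) ord)))

    sum-blocksIn : sum (map (λ i → blocksIn i w u) (letters u)) ≡ max w
    sum-blocksIn = trans (cong sum (List.map-cong (blocksIn≡count u w w≽u) (letters u)))
      (trans (sum-count ℕ._≟_ letters! (All.tabulate λ l∈ → colours⊆ l∈)) (List.length-tabulate _))
      where
      colours⊆ : ∀ {l} → l ∈ₗ tabulate (colour w c w≽u) → l ∈ₗ letters u
      colours⊆ l∈ with a , refl ← ∈ₗ.∈-tabulate⁻ l∈ = colour∈ a

-- The binomial identity in the field

product≢0⇒all≢0 : ∀ ls → .{{NonZero (product ls)}} → All NonZero ls
product≢0⇒all≢0 []       = []
product≢0⇒all≢0 (l ∷ ls) =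
  ℕ.m*n≢0⇒m≢0 l {product ls} ∷ product≢0⇒all≢0 ls {{ℕ.m*n≢0⇒n≢0 l}}

sum-pred : ∀ {ls} → All NonZero ls → sum (map pred ls) ℕ.+ length ls ≡ sum ls
sum-pred []                        = refl
sum-pred {suc l ∷ ls} (_ ∷ ls≢0) = begin
  l ℕ.+ sum (map pred ls) ℕ.+ suc (length ls)   ≡⟨ ℕ.+-suc _ _ ⟩
  suc (l ℕ.+ sum (map pred ls) ℕ.+ length ls)   ≡⟨ cong suc (ℕ.+-assoc l _ _) ⟩
  suc (l ℕ.+ (sum (map pred ls) ℕ.+ length ls)) ≡⟨ cong (λ s → suc (l ℕ.+ s)) (sum-pred ls≢0) ⟩
  suc (l ℕ.+ sum ls)                            ∎
  where open ≡-Reasoning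

k!*nCk-step : ∀ n k → suc k ! ℕ.* (n C suc k) ℕ.+ k ! ℕ.* (n C k) ℕ.* k ≡ k ! ℕ.* (n C k) ℕ.* n
k!*nCk-step n k = trans
  (solve 4 (λ k f b c → ((con 1 :+ k) :* f) :* c :+ (f :* b) :* k := f :* ((con 1 :+ k) :* c :+ k :* b))
    refl k (k !) (n C k) (n C suc k))
  (trans (cong (k ! ℕ.*_) ([1+k]*nC[1+k]+k*nCk≡n*nCk n k))
  (solve 3 (λ f n b → f :* (n :* b) := (f :* b) :* n) refl (k !) n (n C k)))
  where open ℕSolver using (solve; con; _:+_; _:*_; _:=_)

module _ {c ℓ₁ ℓ₂} (𝕂 : HeytingField c ℓ₁ ℓ₂) (char0 : CharacteristicZero 𝕂) where

  open WQSym 𝕂 char0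
  private module K = CommutativeRing commutativeRing
  open K using (+-cong; +-congˡ; +-congʳ; *-cong; *-congˡ; *-congʳ;
                +-identityˡ; +-identityʳ; *-identityˡ; *-identityʳ; zeroˡ; zeroʳ)
  open SetoidReasoning K.setoid
  open SemiringSolver K.commutativeSemiring using (solve; con; _:+_; _:*_; _:=_)
  open SemiringMult K.semiring using (×1-homo-*; ×-homo-+)
  open SemiringExp K.semiring using (^-homo-*; ^-congʳ)
  open RingProperties K.ring using (-1*x≈-x; +-cancelʳ)

  fromℕ-+ : ∀ m n → fromℕ (m ℕ.+ n) ≈ fromℕ m + fromℕ n
  fromℕ-+ = ×-homo-+ 1#

  fromℕ-* : ∀ m n → fromℕ (m ℕ.* n) ≈ fromℕ m * fromℕ n
  fromℕ-* = ×1-homo-*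

  fromℕ-divide : ∀ n .{{_ : NonZero n}} {x y} → fromℕ n * x ≈ y → x ≈ y * 1/ n
  fromℕ-divide n {x} {y} eq = begin
    x                      ≈⟨ *-identityˡ x ⟨
    1# * x                 ≈⟨ *-congʳ (1/-inverse n) ⟨
    fromℕ n * 1/ n * x     ≈⟨ solve 3 (λ a b x → a :* b :* x := a :* x :* b) K.refl (fromℕ n) (1/ n) x ⟩
    fromℕ n * x * 1/ n     ≈⟨ *-congʳ eq ⟩
    y * 1/ n               ∎

  -- Evaluation of polynomials

  coeff-⊕ : ∀ k p q → coeff k (p ⊕ q) ≈ coeff k p + coeff k q
  coeff-⊕ k       []      q       = K.sym (+-identityˡ _)
  coeff-⊕ zero    (a ∷ p) []      = K.sym (+-identityʳ _)
  coeff-⊕ (suc k) (a ∷ p) []      = K.sym (+-identityʳ _)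
  coeff-⊕ zero    (a ∷ p) (b ∷ q) = K.refl
  coeff-⊕ (suc k) (a ∷ p) (b ∷ q) = coeff-⊕ k p q

  coeff-∙ : ∀ k a p → coeff k (a ∙ p) ≈ a * coeff k p
  coeff-∙ k       a []      = K.sym (zeroʳ a)
  coeff-∙ zero    a (b ∷ p) = K.refl
  coeff-∙ (suc k) a (b ∷ p) = coeff-∙ k a p

  coeff-⊗-low : ∀ k p q → (∀ {j} → j < k → coeff j q ≈ 0#) → coeff k (p ⊗ q) ≈ coeff 0 p * coeff k q
  coeff-⊗-low k       []      q low = K.sym (zeroˡ _)
  coeff-⊗-low zero    (a ∷ p) q low = K.trans (coeff-⊕ 0 (a ∙ q) (0# ∷ (p ⊗ q)))
    (K.trans (+-identityʳ _) (coeff-∙ 0 a q))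
  coeff-⊗-low (suc k) (a ∷ p) q low = begin
    coeff (suc k) ((a ∙ q) ⊕ (0# ∷ (p ⊗ q)))  ≈⟨ coeff-⊕ (suc k) (a ∙ q) (0# ∷ (p ⊗ q)) ⟩
    coeff (suc k) (a ∙ q) + coeff k (p ⊗ q)   ≈⟨ +-cong (coeff-∙ (suc k) a q) (coeff-⊗-low k p q (low ∘ ℕ.m≤n⇒m≤1+n)) ⟩
    a * coeff (suc k) q + coeff 0 p * coeff k q ≈⟨ +-congˡ (K.trans (*-congˡ (low ℕ.≤-refl)) (zeroʳ _)) ⟩
    a * coeff (suc k) q + 0#                  ≈⟨ +-identityʳ _ ⟩
    a * coeff (suc k) q                       ∎

  coeff-⊗-next : ∀ k p q → (∀ {j} → j < k → coeff j q ≈ 0#) →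
                 coeff (suc k) (p ⊗ q) ≈ coeff 0 p * coeff (suc k) q + coeff 1 p * coeff k q
  coeff-⊗-next k []      q low = K.sym (K.trans (+-cong (zeroˡ _) (zeroˡ _)) (+-identityʳ _))
  coeff-⊗-next k (a ∷ p) q low = begin
    coeff (suc k) ((a ∙ q) ⊕ (0# ∷ (p ⊗ q)))    ≈⟨ coeff-⊕ (suc k) (a ∙ q) (0# ∷ (p ⊗ q)) ⟩
    coeff (suc k) (a ∙ q) + coeff k (p ⊗ q)     ≈⟨ +-cong (coeff-∙ (suc k) a q) (coeff-⊗-low k p q low) ⟩
    a * coeff (suc k) q + coeff 0 p * coeff k q ∎

  eval : Poly → Carrier → Carrier
  eval []      t = 0#
  eval (a ∷ p) t = a + t * eval p t

  eval-⊕ : ∀ p q t → eval (p ⊕ q) t ≈ eval p t + eval q t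
  eval-⊕ []      q       t = K.sym (+-identityˡ _)
  eval-⊕ (a ∷ p) []      t = K.sym (+-identityʳ _)
  eval-⊕ (a ∷ p) (b ∷ q) t = begin
    a + b + t * eval (p ⊕ q) t        ≈⟨ +-congˡ (*-congˡ (eval-⊕ p q t)) ⟩
    a + b + t * (eval p t + eval q t) ≈⟨ solve 5 (λ a b t x y → a :+ b :+ t :* (x :+ y) := (a :+ t :* x) :+ (b :+ t :* y))
                                           K.refl a b t (eval p t) (eval q t) ⟩
    (a + t * eval p t) + (b + t * eval q t) ∎

  eval-∙ : ∀ a p t → eval (a ∙ p) t ≈ a * eval p t
  eval-∙ a []      t = K.sym (zeroʳ a)
  eval-∙ a (b ∷ p) t = begin
    a * b + t * eval (a ∙ p) t   ≈⟨ +-congˡ (*-congˡ (eval-∙ a p t)) ⟩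
    a * b + t * (a * eval p t)   ≈⟨ solve 4 (λ a b t x → a :* b :+ t :* (a :* x) := a :* (b :+ t :* x)) K.refl a b t (eval p t) ⟩
    a * (b + t * eval p t)       ∎

  eval-⊗ : ∀ p q t → eval (p ⊗ q) t ≈ eval p t * eval q t
  eval-⊗ []      q t = K.sym (zeroˡ _)
  eval-⊗ (a ∷ p) q t = begin
    eval ((a ∙ q) ⊕ (0# ∷ (p ⊗ q))) t            ≈⟨ eval-⊕ (a ∙ q) (0# ∷ (p ⊗ q)) t ⟩
    eval (a ∙ q) t + (0# + t * eval (p ⊗ q) t)   ≈⟨ +-cong (eval-∙ a q t) (K.trans (+-identityˡ _) (*-congˡ (eval-⊗ p q t))) ⟩
    a * eval q t + t * (eval p t * eval q t)     ≈⟨ solve 4 (λ a t x y → a :* y :+ t :* (x :* y) := (a :+ t :* x) :* y)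
                                                      K.refl a t (eval p t) (eval q t) ⟩
    (a + t * eval p t) * eval q t                ∎

  -- The quotient of a ∷ p by t - α; it does not depend on a.
  quotient : Poly → Carrier → Poly
  quotient []      α = []
  quotient (b ∷ p) α = eval (b ∷ p) α ∷ quotient p α

  length-quotient : ∀ p α → length (quotient p α) ≡ length p
  length-quotient []      α = refl
  length-quotient (b ∷ p) α = cong suc (length-quotient p α)

  eval-quotient : ∀ a p α t → eval (a ∷ p) t + α * eval (quotient p α) t ≈
                              eval (a ∷ p) α + t * eval (quotient p α) t
  eval-quotient a []      α t = solve 3 (λ a α t → (a :+ t :* con 0) :+ α :* con 0 := (a :+ α :* con 0) :+ t :* con 0) K.refl a α t
  eval-quotient a (b ∷ p) α t = begin
    (a + t * pt) + α * (pα + t * qt)   ≈⟨ solve 6 (λ a α t x y z → (a :+ t :* x) :+ α :* (y :+ t :* z) := (a :+ t :* (x :+ α :* z)) :+ α :* y)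
                                            K.refl a α t pt pα qt ⟩
    (a + t * (pt + α * qt)) + α * pα   ≈⟨ +-congʳ (+-congˡ (*-congˡ (eval-quotient b p α t))) ⟩
    (a + t * (pα + t * qt)) + α * pα   ≈⟨ solve 5 (λ a α t y z → (a :+ t :* (y :+ t :* z)) :+ α :* y := (a :+ α :* y) :+ t :* (y :+ t :* z))
                                            K.refl a α t pα qt ⟩
    (a + α * pα) + t * (pα + t * qt)   ∎
    where
    pt = eval (b ∷ p) t
    pα = eval (b ∷ p) α
    qt = eval (quotient p α) t

  eval-zero : ∀ p t → (∀ k → coeff k p ≈ 0#) → eval p t ≈ 0#
  eval-zero []      t p≈0 = K.refl
  eval-zero (a ∷ p) t p≈0 = K.trans (+-cong (p≈0 0) (K.trans (*-congˡ (eval-zero p t (p≈0 ∘ suc))) (zeroʳ t))) (+-identityʳ 0#)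

  constant-zero : ∀ a p t → eval (a ∷ p) t ≈ 0# → (∀ k → coeff k p ≈ 0#) → ∀ k → coeff k (a ∷ p) ≈ 0#
  constant-zero a p t e p≈0 zero = begin
    a                 ≈⟨ +-identityʳ a ⟨
    a + 0#            ≈⟨ +-congˡ (K.trans (*-congˡ (eval-zero p t p≈0)) (zeroʳ t)) ⟨
    a + t * eval p t  ≈⟨ e ⟩
    0#                ∎
  constant-zero a p t e p≈0 (suc k) = p≈0 k

  quotient-zero : ∀ p α → (∀ k → coeff k (quotient p α) ≈ 0#) → ∀ k → coeff k p ≈ 0#
  quotient-zero []      α q≈0 = q≈0
  quotient-zero (b ∷ p) α q≈0 = constant-zero b p α (q≈0 0) (quotient-zero p α (q≈0 ∘ suc))

  roots⇒zero : ∀ p s → (∀ d → eval p (fromℕ (d ℕ.+ s)) ≈ 0#) → ∀ k → coeff k p ≈ 0#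
  roots⇒zero p = go (length p) p refl
    where
    go : ∀ l p → length p ≡ l → ∀ s → (∀ d → eval p (fromℕ (d ℕ.+ s)) ≈ 0#) → ∀ k → coeff k p ≈ 0#
    go _ []      _ s roots k = K.refl
    go (suc l) (a ∷ p) eq s roots = constant-zero a p α (roots 0) (quotient-zero p α
      (go l (quotient p α) (trans (length-quotient p α) (ℕ.suc-injective eq)) (suc s) λ d →
        subst (λ e → eval (quotient p α) (fromℕ e) ≈ 0#) (sym (ℕ.+-suc d s)) (root d)))
      where
      α = fromℕ s

      root : ∀ d → eval (quotient p α) (fromℕ (suc d ℕ.+ s)) ≈ 0#
      root d = K.trans (fromℕ-divide (suc d) (+-cancelʳ (α * q) (fromℕ (suc d) * q) 0# (begin
        fromℕ (suc d) * q + α * q         ≈⟨ K.distribʳ q _ _ ⟨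
        (fromℕ (suc d) + α) * q           ≈⟨ *-congʳ (fromℕ-+ (suc d) s) ⟨
        t * q                             ≈⟨ +-identityˡ _ ⟨
        0# + t * q                        ≈⟨ +-congʳ (roots 0) ⟨
        eval (a ∷ p) α + t * q            ≈⟨ eval-quotient a p α t ⟨
        eval (a ∷ p) t + α * q            ≈⟨ +-congʳ (roots (suc d)) ⟩
        0# + α * q                        ∎))) (zeroˡ _)
        where
        t = fromℕ (suc d ℕ.+ s)
        q = eval (quotient p α) t

  eval⇒coeff : ∀ p q → (∀ m → eval p (fromℕ m) ≈ eval q (fromℕ m)) → ∀ k → coeff k p ≈ coeff k q
  eval⇒coeff p q eq k = +-cancelʳ (- 1# * coeff k q) _ _ (begin
    coeff k p + - 1# * coeff k q       ≈⟨ +-congˡ (coeff-∙ k (- 1#) q) ⟨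
    coeff k p + coeff k ((- 1#) ∙ q)   ≈⟨ coeff-⊕ k p ((- 1#) ∙ q) ⟨
    coeff k (p ⊕ ((- 1#) ∙ q))         ≈⟨ roots⇒zero (p ⊕ ((- 1#) ∙ q)) 0 (λ d → root (d ℕ.+ 0)) k ⟩
    0#                                 ≈⟨ cancel (coeff k q) ⟨
    coeff k q + - 1# * coeff k q       ∎)
    where
    cancel : ∀ x → x + - 1# * x ≈ 0#
    cancel x = K.trans (+-congˡ (-1*x≈-x x)) (K.-‿inverseʳ x)

    root : ∀ m → eval (p ⊕ ((- 1#) ∙ q)) (fromℕ m) ≈ 0#
    root m = begin
      eval (p ⊕ ((- 1#) ∙ q)) (fromℕ m)               ≈⟨ eval-⊕ p ((- 1#) ∙ q) (fromℕ m) ⟩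
      eval p (fromℕ m) + eval ((- 1#) ∙ q) (fromℕ m)  ≈⟨ +-cong (eq m) (eval-∙ (- 1#) q (fromℕ m)) ⟩
      eval q (fromℕ m) + - 1# * eval q (fromℕ m)      ≈⟨ cancel _ ⟩
      0#                                              ∎

  -- Binomial polynomials

  private
    linear : ℕ → Poly
    linear k = (- fromℕ k) ∷ 1# ∷ []

  eval-fallingFactorial : ∀ k m → eval (fallingFactorial k) (fromℕ m) ≈ fromℕ (k ! ℕ.* (m C k))
  eval-fallingFactorial zero    m = K.trans (+-congˡ (zeroʳ _)) K.refl
  eval-fallingFactorial (suc k) m = +-cancelʳ (x * fromℕ k) _ _ (begin
    eval (fallingFactorial k ⊗ linear k) (fromℕ m) + x * fromℕ k
      ≈⟨ +-congʳ (eval-⊗ (fallingFactorial k) (linear k) (fromℕ m)) ⟩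
    eval (fallingFactorial k) (fromℕ m) * eval (linear k) (fromℕ m) + x * fromℕ k
      ≈⟨ +-congʳ (*-congʳ (eval-fallingFactorial k m)) ⟩
    x * (- fromℕ k + fromℕ m * (1# + fromℕ m * 0#)) + x * fromℕ k
      ≈⟨ solve 4 (λ x y k m → x :* (y :+ m :* (con 1 :+ m :* con 0)) :+ x :* k := x :* (y :+ k) :+ x :* m)
           K.refl x (- fromℕ k) (fromℕ k) (fromℕ m) ⟩
    x * (- fromℕ k + fromℕ k) + x * fromℕ m
      ≈⟨ +-congʳ (K.trans (*-congˡ (K.-‿inverseˡ _)) (zeroʳ x)) ⟩
    0# + x * fromℕ m
      ≈⟨ +-identityˡ _ ⟩
    x * fromℕ m
      ≈⟨ fromℕ-* (k ! ℕ.* (m C k)) m ⟨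
    fromℕ (k ! ℕ.* (m C k) ℕ.* m)
      ≈⟨ K.reflexive (cong fromℕ (k!*nCk-step m k)) ⟨
    fromℕ (suc k ! ℕ.* (m C suc k) ℕ.+ k ! ℕ.* (m C k) ℕ.* k)
      ≈⟨ fromℕ-+ (suc k ! ℕ.* (m C suc k)) _ ⟩
    fromℕ (suc k ! ℕ.* (m C suc k)) + fromℕ (k ! ℕ.* (m C k) ℕ.* k)
      ≈⟨ +-congˡ (fromℕ-* (k ! ℕ.* (m C k)) k) ⟩
    fromℕ (suc k ! ℕ.* (m C suc k)) + x * fromℕ k ∎)
    where
    x = fromℕ (k ! ℕ.* (m C k))

  eval-binomial : ∀ k m → eval (binomial-t k) (fromℕ m) ≈ fromℕ (m C k)
  eval-binomial k m = begin
    eval (f ∙ fallingFactorial k) (fromℕ m)       ≈⟨ eval-∙ f (fallingFactorial k) (fromℕ m) ⟩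
    f * eval (fallingFactorial k) (fromℕ m)       ≈⟨ *-congˡ (K.trans (eval-fallingFactorial k m) (fromℕ-* (k !) (m C k))) ⟩
    f * (fromℕ (k !) * fromℕ (m C k))             ≈⟨ solve 3 (λ f g b → f :* (g :* b) := g :* f :* b) K.refl f (fromℕ (k !)) (fromℕ (m C k)) ⟩
    fromℕ (k !) * f * fromℕ (m C k)               ≈⟨ *-congʳ (1/-inverse (k !) {{ℕ._!≢0 k}}) ⟩
    1# * fromℕ (m C k)                            ≈⟨ *-identityˡ _ ⟩
    fromℕ (m C k)                                 ∎
    where f = (1/ (k !)) {{ℕ._!≢0 k}}

  coeff₀-fallingFactorial : ∀ k → coeff 0 (fallingFactorial (suc k)) ≈ 0#
  coeff₀-fallingFactorial k = K.trans (coeff-⊗-low 0 (fallingFactorial k) (linear k) λ ()) (zero-factor k)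
    where
    zero-factor : ∀ k → coeff 0 (fallingFactorial k) * - fromℕ k ≈ 0#
    zero-factor zero    = K.trans (*-identityˡ _) (RingProperties.-0#≈0# K.ring)
    zero-factor (suc k) = K.trans (*-congʳ (coeff₀-fallingFactorial k)) (zeroˡ _)

  coeff₁-fallingFactorial : ∀ k → coeff 1 (fallingFactorial (suc k)) ≈ (- 1#) ^ k * fromℕ (k !)
  coeff₁-fallingFactorial k = K.trans (coeff-⊗-next 0 (fallingFactorial k) (linear k) λ ()) (next k)
    where
    next : ∀ k → coeff 0 (fallingFactorial k) * 1# + coeff 1 (fallingFactorial k) * - fromℕ k ≈
                 (- 1#) ^ k * fromℕ (k !)
    next zero    = K.trans (+-congˡ (zeroˡ _)) (K.trans (+-identityʳ _) (*-congˡ (K.sym (+-identityʳ 1#))))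
    next (suc k) = begin
      coeff 0 (fallingFactorial (suc k)) * 1# + coeff 1 (fallingFactorial (suc k)) * - fromℕ (suc k)
        ≈⟨ +-cong (K.trans (*-identityʳ _) (coeff₀-fallingFactorial k))
             (*-cong (coeff₁-fallingFactorial k) (K.sym (-1*x≈-x _))) ⟩
      0# + (- 1#) ^ k * fromℕ (k !) * (- 1# * fromℕ (suc k))
        ≈⟨ solve 4 (λ s f i l → con 0 :+ s :* f :* (i :* l) := i :* s :* (l :* f)) K.refl
             ((- 1#) ^ k) (fromℕ (k !)) (- 1#) (fromℕ (suc k)) ⟩
      (- 1#) ^ suc k * (fromℕ (suc k) * fromℕ (k !))
        ≈⟨ *-congˡ (fromℕ-* (suc k) (k !)) ⟨
      (- 1#) ^ suc k * fromℕ (suc k !) ∎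

  coeff₀-binomial : ∀ k → coeff 0 (binomial-t (suc k)) ≈ 0#
  coeff₀-binomial k = K.trans (coeff-∙ 0 _ (fallingFactorial (suc k)))
    (K.trans (*-congˡ (coeff₀-fallingFactorial k)) (zeroʳ _))

  coeff₁-binomial : ∀ k → fromℕ (suc k) * coeff 1 (binomial-t (suc k)) ≈ (- 1#) ^ k
  coeff₁-binomial k = begin
    fromℕ (suc k) * coeff 1 (binomial-t (suc k))
      ≈⟨ *-congˡ (K.trans (coeff-∙ 1 f (fallingFactorial (suc k))) (*-congˡ (coeff₁-fallingFactorial k))) ⟩
    fromℕ (suc k) * (f * ((- 1#) ^ k * fromℕ (k !)))
      ≈⟨ solve 4 (λ l f s g → l :* (f :* (s :* g)) := l :* g :* f :* s) K.refl (fromℕ (suc k)) f ((- 1#) ^ k) (fromℕ (k !)) ⟩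
    fromℕ (suc k) * fromℕ (k !) * f * (- 1#) ^ k
      ≈⟨ *-congʳ (*-congʳ (fromℕ-* (suc k) (k !))) ⟨
    fromℕ (suc k !) * f * (- 1#) ^ k
      ≈⟨ *-congʳ (1/-inverse (suc k !) {{ℕ._!≢0 (suc k)}}) ⟩
    1# * (- 1#) ^ k
      ≈⟨ *-identityˡ _ ⟩
    (- 1#) ^ k ∎
    where f = (1/ (suc k !)) {{ℕ._!≢0 (suc k)}}

  binomialProduct : List ℕ → Poly
  binomialProduct = foldr (λ l q → binomial-t l ⊗ q) (1# ∷ [])

  eval-binomialProduct : ∀ ls m → eval (binomialProduct ls) (fromℕ m) ≈ fromℕ (product (map (m C_) ls))
  eval-binomialProduct []       m = +-congˡ (zeroʳ _)
  eval-binomialProduct (l ∷ ls) m = begin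
    eval (binomial-t l ⊗ binomialProduct ls) (fromℕ m)
      ≈⟨ eval-⊗ (binomial-t l) (binomialProduct ls) (fromℕ m) ⟩
    eval (binomial-t l) (fromℕ m) * eval (binomialProduct ls) (fromℕ m)
      ≈⟨ *-cong (eval-binomial l m) (eval-binomialProduct ls m) ⟩
    fromℕ (m C l) * fromℕ (product (map (m C_) ls))
      ≈⟨ fromℕ-* (m C l) _ ⟨
    fromℕ (product (map (m C_) (l ∷ ls))) ∎

  binomialProduct-low : ∀ {ls} → All NonZero ls → ∀ {j} → j < length ls → coeff j (binomialProduct ls) ≈ 0#
  binomialProduct-low {suc k ∷ ls} (_ ∷ ls≢0) {zero} _ =
    K.trans (coeff-⊗-low 0 (binomial-t (suc k)) (binomialProduct ls) λ ())
      (K.trans (*-congʳ (coeff₀-binomial k)) (zeroˡ _))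
  binomialProduct-low {suc k ∷ ls} (_ ∷ ls≢0) {suc j} (s≤s j<) = begin
    coeff (suc j) (binomial-t (suc k) ⊗ q)
      ≈⟨ coeff-⊗-next j (binomial-t (suc k)) q (λ i<j → binomialProduct-low ls≢0 (ℕ.<-trans i<j j<)) ⟩
    coeff 0 (binomial-t (suc k)) * coeff (suc j) q + coeff 1 (binomial-t (suc k)) * coeff j q
      ≈⟨ +-cong (K.trans (*-congʳ (coeff₀-binomial k)) (zeroˡ _))
                (K.trans (*-congˡ (binomialProduct-low ls≢0 j<)) (zeroʳ _)) ⟩
    0# + 0#
      ≈⟨ +-identityʳ 0# ⟩
    0# ∎
    where q = binomialProduct ls

  binomialProduct-lowest : ∀ {ls} → All NonZero ls →
    fromℕ (product ls) * coeff (length ls) (binomialProduct ls) ≈ (- 1#) ^ sum (map pred ls)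
  binomialProduct-lowest [] = K.trans (*-identityʳ _) (+-identityʳ 1#)
  binomialProduct-lowest {suc k ∷ ls} (_ ∷ ls≢0) = begin
    fromℕ (suc k ℕ.* product ls) * coeff (suc r) (binomial-t (suc k) ⊗ q)
      ≈⟨ *-cong (fromℕ-* (suc k) (product ls)) (coeff-⊗-next r (binomial-t (suc k)) q (binomialProduct-low ls≢0)) ⟩
    fromℕ (suc k) * fromℕ (product ls) * (coeff 0 (binomial-t (suc k)) * coeff (suc r) q + coeff 1 (binomial-t (suc k)) * coeff r q)
      ≈⟨ *-congˡ (K.trans (+-congʳ (K.trans (*-congʳ (coeff₀-binomial k)) (zeroˡ _))) (+-identityˡ _)) ⟩
    fromℕ (suc k) * fromℕ (product ls) * (coeff 1 (binomial-t (suc k)) * coeff r q)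
      ≈⟨ solve 4 (λ a b x y → a :* b :* (x :* y) := a :* x :* (b :* y)) K.refl _ _ _ _ ⟩
    fromℕ (suc k) * coeff 1 (binomial-t (suc k)) * (fromℕ (product ls) * coeff r q)
      ≈⟨ *-cong (coeff₁-binomial k) (binomialProduct-lowest ls≢0) ⟩
    (- 1#) ^ k * (- 1#) ^ sum (map pred ls)
      ≈⟨ ^-homo-* (- 1#) k _ ⟨
    (- 1#) ^ (k ℕ.+ sum (map pred ls)) ∎
    where
    q = binomialProduct ls
    r = length ls

  binomialSum : List ℕ → Poly
  binomialSum = foldr (λ l p → binomial-t l ⊕ p) []

  eval-binomialSum : ∀ ls m → eval (binomialSum ls) (fromℕ m) ≈ fromℕ (sum (map (m C_) ls))
  eval-binomialSum []       m = K.refl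
  eval-binomialSum (l ∷ ls) m = begin
    eval (binomial-t l ⊕ binomialSum ls) (fromℕ m)
      ≈⟨ eval-⊕ (binomial-t l) (binomialSum ls) (fromℕ m) ⟩
    eval (binomial-t l) (fromℕ m) + eval (binomialSum ls) (fromℕ m)
      ≈⟨ +-cong (eval-binomial l m) (eval-binomialSum ls m) ⟩
    fromℕ (m C l) + fromℕ (sum (map (m C_) ls))
      ≈⟨ fromℕ-+ (m C l) _ ⟨
    fromℕ (sum (map (m C_) (l ∷ ls))) ∎

  -- Expansions in the basis N

  total : ∀ {A : Set} → List A → (A → Carrier) → Carrier
  total xs f = foldr (λ x s → f x + s) 0# xs

  module _ {A : Set} where

    total-cong : ∀ {f g : A → Carrier} xs → (∀ x → f x ≈ g x) → total xs f ≈ total xs g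
    total-cong []       f≈g = K.refl
    total-cong (x ∷ xs) f≈g = +-cong (f≈g x) (total-cong xs f≈g)

    total-zero : ∀ {f : A → Carrier} xs → (∀ {x} → x ∈ₗ xs → f x ≈ 0#) → total xs f ≈ 0#
    total-zero []       f≈0 = K.refl
    total-zero (x ∷ xs) f≈0 = K.trans (+-cong (f≈0 (here refl)) (total-zero xs (f≈0 ∘ there))) (+-identityʳ 0#)

    total-single : ∀ {f : A → Carrier} {x xs} → Unique xs → x ∈ₗ xs →
                   (∀ {y} → y ≢ x → f y ≈ 0#) → total xs f ≈ f x
    total-single {xs = x ∷ xs} (x≢xs ∷ _) (here refl) f≈0 =
      K.trans (+-congˡ (total-zero xs λ y∈ → f≈0 (≢-sym (All.lookup x≢xs y∈)))) (+-identityʳ _)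
    total-single (y≢xs ∷ xs!) (there x∈) f≈0 =
      K.trans (+-cong (f≈0 (All.lookup y≢xs x∈)) (total-single xs! x∈ f≈0)) (+-identityˡ _)

    total-filter : ∀ {P : A → Set} (P? : Decidable P) (f : A → Carrier) xs →
                   total xs (λ x → f x * (if does (P? x) then 1# else 0#)) ≈ total (filter P? xs) f
    total-filter P? f []       = K.refl
    total-filter P? f (x ∷ xs) with does (P? x)
    ... | true  = +-cong (*-identityʳ _) (total-filter P? f xs)
    ... | false = K.trans (+-cong (zeroʳ _) (total-filter P? f xs)) (+-identityˡ _)

  N-≡ : ∀ {n} (u : PackedWord n) → N u u ≡ 1#
  N-≡ u = cong (if_then 1# else 0#) (dec-true (u ≟ u) refl)

  N-≢ : ∀ {n} {u v : PackedWord n} → u ≢ v → N u v ≡ 0#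
  N-≢ {u = u} {v} u≢v = cong (if_then 1# else 0#) (dec-false (u ≟ v) u≢v)

  •N-≢ : ∀ {n} (u v : PackedWord n) a → u ≢ v → (a • N u) v ≈ 0#
  •N-≢ u v a u≢v = K.trans (*-congˡ (K.reflexive (N-≢ u≢v))) (zeroʳ a)

  •N-≡ : ∀ {n} (u : PackedWord n) a → (a • N u) u ≈ a
  •N-≡ u a = K.trans (*-congˡ (K.reflexive (N-≡ u))) (*-identityʳ a)

  E-coeff : ∀ n k (v : PackedWord n) → E n k v ≈ coeff k (binomial-t (max v))
  E-coeff n k v = K.trans (total-single (packedWords-unique n) (packedWords-complete v) λ {u} u≢v → •N-≢ u v _ u≢v) (•N-≡ v _)

  coeff-binomialSum : ∀ {n} k (vs : List (PackedWord n)) →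
    total vs (λ v → coeff k (binomial-t (max v))) ≈ coeff k (binomialSum (map max vs))
  coeff-binomialSum k []       = K.refl
  coeff-binomialSum k (v ∷ vs) = K.trans (+-congˡ (coeff-binomialSum k vs)) (K.sym (coeff-⊕ k (binomial-t (max v)) _))

  𝐊-coeff : ∀ {n} (u w : PackedWord n) →
            𝐊 u w ≈ coeff (max u) (binomialSum (map max (refinedBy u w)))
  𝐊-coeff {n} u w = begin
    𝐊 u w
      ≈⟨ total-single (packedWords-unique n) (packedWords-complete u) (λ {u′} u′≢u → total-zero (packedWords n) λ {v} _ →
           K.trans (*-congʳ (K.trans (*-congʳ (K.reflexive (N-≢ (≢-sym u′≢u)))) (zeroˡ (E n (max u) v)))) (zeroˡ _)) ⟩
    total (packedWords n) (λ v → N u u * E n (max u) v * N (packBi u v) w)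
      ≈⟨ total-cong (packedWords n) (λ v → *-congʳ (K.trans (*-cong (K.reflexive (N-≡ u)) (E-coeff n (max u) v)) (*-identityˡ _))) ⟩
    total (packedWords n) (λ v → coeff (max u) (binomial-t (max v)) * N (packBi u v) w)
      ≈⟨ total-filter (λ v → packBi u v ≟ w) (λ v → coeff (max u) (binomial-t (max v))) (packedWords n) ⟩
    total (refinedBy u w) (λ v → coeff (max u) (binomial-t (max v)))
      ≈⟨ coeff-binomialSum (max u) (refinedBy u w) ⟩
    coeff (max u) (binomialSum (map max (refinedBy u w))) ∎

  𝐊-finer : ∀ {n} (u w : PackedWord n) → w ≽ u → 𝐊 u w ≈ expansionCoeff w u
  𝐊-finer {n} u w w≽u = begin
    𝐊 u w
      ≈⟨ 𝐊-coeff u w ⟩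
    coeff (max u) (binomialSum (map max (refinedBy u w)))
      ≈⟨ eval⇒coeff (binomialSum (map max (refinedBy u w))) (binomialProduct ls) evals (max u) ⟩
    coeff (max u) (binomialProduct ls)
      ≈⟨ K.reflexive (cong (λ r → coeff r (binomialProduct ls)) length-ls) ⟨
    coeff (length ls) (binomialProduct ls)
      ≈⟨ fromℕ-divide (blocksProduct w u) {{blocksProduct≢0 w u}} (binomialProduct-lowest ls≢0) ⟩
    (- 1#) ^ sum (map pred ls) * (1/ blocksProduct w u) {{blocksProduct≢0 w u}}
      ≈⟨ *-congʳ (^-congʳ (- 1#) exponent) ⟩
    expansionCoeff w u ∎
    where
    ls : List ℕ
    ls = map (λ i → blocksIn i w u) (letters u)

    ls≢0 : All NonZero ls
    ls≢0 = product≢0⇒all≢0 ls {{blocksProduct≢0 w u}}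

    length-ls : length ls ≡ max u
    length-ls = trans (List.length-map (λ i → blocksIn i w u) (letters u))
      (trans (List.length-map suc (upTo (max u))) (List.length-upTo (max u)))

    exponent : sum (map pred ls) ≡ max w ∸ max u
    exponent = trans (sym (ℕ.m+n∸n≡m (sum (map pred ls)) (length ls)))
      (cong₂ _∸_ (trans (sum-pred ls≢0) (sum-blocksIn u w w≽u)) length-ls)

    evals : ∀ m → eval (binomialSum (map max (refinedBy u w))) (fromℕ m) ≈ eval (binomialProduct ls) (fromℕ m)
    evals m = begin
      eval (binomialSum (map max (refinedBy u w))) (fromℕ m)
        ≈⟨ eval-binomialSum (map max (refinedBy u w)) m ⟩
      fromℕ (sum (map (m C_) (map max (refinedBy u w))))
        ≈⟨ K.reflexive (cong fromℕ (trans (cong sum (sym (List.map-∘ (refinedBy u w))))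
             (trans (sum-binomial u w w≽u m) (cong product (List.map-∘ (letters u)))))) ⟩
      fromℕ (product (map (m C_) ls))
        ≈⟨ eval-binomialProduct ls m ⟨
      eval (binomialProduct ls) (fromℕ m) ∎

  𝐊-not-finer : ∀ {n} (u w : PackedWord n) → ¬ (w ≽ u) → 𝐊 u w ≈ 0#
  𝐊-not-finer {n} u w w⋡u = K.trans (𝐊-coeff u w) (K.reflexive (cong (coeff (max u) ∘ binomialSum ∘ map max)
    (List.filter-none (λ v → packBi u v ≟ w) (All.universal (λ v → w⋡u ∘ packBi≡⇒≽ u v w) (packedWords n)))))

  expansion-finer : ∀ {n} (u w : PackedWord n) → w ≽ u →
                    ∑ (finerThan u) (λ v → expansionCoeff v u • N v) w ≈ expansionCoeff w u
  expansion-finer {n} u w w≽u = K.trans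
    (total-single (Unique.filter⁺ (_≽? u) (packedWords-unique n)) (∈ₗ.∈-filter⁺ (_≽? u) (packedWords-complete w) w≽u)
      λ {v} v≢w → •N-≢ v w _ v≢w)
    (•N-≡ w _)

  expansion-not-finer : ∀ {n} (u w : PackedWord n) → ¬ (w ≽ u) →
                        ∑ (finerThan u) (λ v → expansionCoeff v u • N v) w ≈ 0#
  expansion-not-finer {n} u w w⋡u = total-zero (finerThan u) λ {v} v∈ → •N-≢ v w _ λ { refl →
    w⋡u (proj₂ (∈ₗ.∈-filter⁻ (_≽? u) {xs = packedWords n} v∈)) }

mainTheorem2 : ∀ {c ℓ₁ ℓ₂} (𝕂 : HeytingField c ℓ₁ ℓ₂) (char0 : CharacteristicZero 𝕂) →
    let open WQSym 𝕂 char0 in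
    ∀ (n : ℕ) (u : PackedWord n) →
    𝐊 u ≋ ∑ (finerThan u) (λ v → expansionCoeff v u • N v)
mainTheorem2 𝕂 char0 n u w with w ≽? u
... | yes w≽u = HeytingField.trans 𝕂 (𝐊-finer 𝕂 char0 u w w≽u)
                  (HeytingField.sym 𝕂 (expansion-finer 𝕂 char0 u w w≽u))
... | no  w⋡u = HeytingField.trans 𝕂 (𝐊-not-finer 𝕂 char0 u w w⋡u)
                  (HeytingField.sym 𝕂 (expansion-not-finer 𝕂 char0 u w w⋡u))
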